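{- Let $n\ge 1$ and let $\mathbf{m}=(m_1,\dots,m_n)$, $\mathbf{r}=(r_1,\dots,r_n)$ be vectors of positive integers, $m=m_1+\cdots+m_n$. Then, as formal power series in the variables $z_1,\dots,z_n,z_{m+1}$, $$\sum_{\pi^{\mathbf{c}}\in\mathfrak{S}_{\mathbf{m}}^{\mathbf{r}}}\frac{z_{\pi_1}^{c_1-1}\cdots z_{\pi_m}^{c_m-1}\prod_{\substack{i\in\{2,\dots,m+1\}\\ i-1\in\mathrm{DES}(\pi^{\mathbf{c}})}}z_{\pi_i}^{r_{\pi_i}}\cdots z_{\pi_m}^{r_{\pi_m}}z_{m+1}}{\prod_{i=1}^{m+1}\bigl(1-z_{\pi_i}^{r_{\pi_i}}\cdots z_{\pi_m}^{r_{\pi_m}}z_{m+1}\bigr)}=\sum_{t\ge 0}z_{m+1}^t\prod_{k=1}^n\begin{bmatrix}r_kt+m_k\\ m_k\end{bmatrix}_{z_k}.$$ For $i=m+1$ the expression $z_{\pi_i}^{r_{\pi_i}}\cdots z_{\pi_m}^{r_{\pi_m}}z_{m+1}$ is just $z_{m+1}$.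
   Context: $\mathfrak{S}_{\mathbf{m}}^{\mathbf{r}}$ denotes the set of colored multiset permutations: words $\pi^{\mathbf{c}}=\pi_1^{c_1}\pi_2^{c_2}\cdots\pi_m^{c_m}$ in which each $k\in\{1,\dots,n\}$ appears exactly $m_k$ times among $\pi_1,\dots,\pi_m$, and each color $c_j$ is an integer with $1\le c_j\le r_{\pi_j}$. One always appends $\pi_{m+1}^{c_{m+1}}:=(n+1)^1$. Colored letters are totally ordered by the color ordering: $k^{c}<l^{c'}$ iff $c<c'$, or $c=c'$ and $k<l$. An index $j\in\{1,\dots,m\}$ is a descent of $\pi^{\mathbf{c}}$ if $\pi_j^{c_j}>\pi_{j+1}^{c_{j+1}}$; $\mathrm{DES}(\pi^{\mathbf{c}})$ is the set of descents. $\begin{bmatrix}N\\ M\end{bmatrix}_q$ is the Gaussian ($q$-)binomial coefficient $\prod_{i=1}^{M}\frac{1-q^{N-M+i}}{1-q^i}$. -}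

module Defs where

open import Algebra.Bundles.Raw using (RawRing)
open import Data.Bool.Base using (if_then_else_)
open import Data.Fin.Base using (Fin; zero; suc; toℕ; inject₁)
import Data.Fin.Properties as Fin
open import Data.Integer.Base as ℤ using (ℤ; 0ℤ; 1ℤ)
open import Data.List.Base
  using (List; []; _∷_; foldr; map; concatMap; upTo; allFin; filter; drop)
open import Data.Nat.Base as ℕ using (ℕ; zero; suc; _∸_; _<_; _≤_)
import Data.Nat.Properties as ℕ
open import Data.Product.Base using (Σ; _×_; _,_; proj₁; proj₂; ∃-syntax)
open import Data.Product.Relation.Binary.Lex.Strict using (×-Lex; ×-decidable)
open import Data.Vec.Base as Vec
  using (Vec; []; _∷_; lookup; replicate; zipWith; _[_]≔_; _∷ʳ_; toList; count)
import Data.Vec.Properties as Vec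
open import Level using (0ℓ)
open import Relation.Binary.Core using (Rel)
open import Relation.Binary.Definitions using (Decidable)
open import Relation.Binary.PropositionalEquality.Core using (_≡_)
open import Relation.Nullary.Decidable.Core using (⌊_⌋)
import Relation.Unary as Unary

module BigOperators {a ℓ} (R : RawRing a ℓ) where
  open RawRing R

  ∑ ∏ : ∀ {b} {B : Set b} → List B → (B → Carrier) → Carrier
  ∑ xs f = foldr _+_ 0# (map f xs)
  ∏ xs f = foldr _*_ 1# (map f xs)

  infix 5 ∑ ∏
  syntax ∑ xs (λ x → e) = ∑[ x ∈ xs ] e
  syntax ∏ xs (λ x → e) = ∏[ x ∈ xs ] e

------------------------------------------------------------------------
-- Formal power series over ℤ in d variables

Exponent : ℕ → Set
Exponent d = Vec ℕ d

degree : ∀ {d} → Exponent d → ℕ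
degree = Vec.sum

-- All β with β ≤ α componentwise, each listed once.
below : ∀ {d} → Exponent d → List (Exponent d)
below []      = [] ∷ []
below (a ∷ α) = concatMap (λ b → map (b ∷_) (below α)) (upTo (suc a))

PowerSeries : ℕ → Set
PowerSeries d = Exponent d → ℤ

monomial : ∀ {d} → Exponent d → PowerSeries d
monomial α β = if ⌊ Vec.≡-dec ℕ._≟_ α β ⌋ then 1ℤ else 0ℤ

powerSeries : ℕ → RawRing 0ℓ 0ℓ
powerSeries d = record
  { Carrier = PowerSeries d
  ; _≈_     = λ f g → ∀ α → f α ≡ g α
  ; _+_     = λ f g α → f α ℤ.+ g α
  ; _*_     = λ f g α → ∑[ β ∈ below α ] (f β ℤ.* g (zipWith _∸_ α β))
  ; -_      = λ f α → ℤ.- f α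
  ; 0#      = λ _ → 0ℤ
  ; 1#      = monomial (replicate d 0)
  }
  where open BigOperators ℤ.+-*-rawRing

module _ {d : ℕ} where
  open RawRing (powerSeries d) public using (_≈_; _+_; _*_; -_; 0#; 1#)
  open import Algebra.Definitions.RawSemiring
    (RawRing.rawSemiring (powerSeries d)) public using (_^_)
  open BigOperators (powerSeries d) public

  infixl 6 _-_
  _-_ : PowerSeries d → PowerSeries d → PowerSeries d
  f - g = f + (- g)

  var : Fin d → PowerSeries d
  var i = monomial (replicate d 0 [ i ]≔ 1)

  -- The inverse of a series f with constant term 1, namely the geometric
  -- series ∑ₜ (1 - f)ᵗ: since 1 - f has no constant term, only the terms
  -- with t ≤ degree α contribute to the coefficient at α.
  infix 8 _⁻¹
  _⁻¹ : PowerSeries d → PowerSeries d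
  (f ⁻¹) α = (∑[ t ∈ upTo (suc (degree α)) ] ((1# - f) ^ t)) α

  infixl 7 _/_
  _/_ : PowerSeries d → PowerSeries d → PowerSeries d
  f / g = f * g ⁻¹

  -- s = ∑_{t ≥ 0} f t as formal power series: every coefficient of the
  -- partial sums is eventually constant, equal to that of s.
  HasSum : (ℕ → PowerSeries d) → PowerSeries d → Set
  HasSum f s =
    ∀ α → ∃[ T₀ ] (∀ T → T₀ ≤ T → (∑[ t ∈ upTo T ] f t) α ≡ s α)

  -- The factors of the numerator are 1 - q^(N-M+i); writing the exponent as
  -- (N + i) ∸ M makes the factor i = M - N vanish when N < M.
  gaussianBinomial : ℕ → ℕ → PowerSeries d → PowerSeries d
  gaussianBinomial N M q =
    ∏[ i ∈ map suc (upTo M) ] ((1# - q ^ ((N ℕ.+ i) ∸ M)) / (1# - q ^ i))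

------------------------------------------------------------------------
-- Colored multiset permutations

-- Plain colored integers k^c, as pairs (c , k), with the color ordering.
ColoredInteger : Set
ColoredInteger = ℕ × ℕ

infix 4 _<ᶜ_ _<ᶜ?_
_<ᶜ_ : Rel ColoredInteger 0ℓ
_<ᶜ_ = ×-Lex _≡_ _<_ _<_

_<ᶜ?_ : Decidable _<ᶜ_
_<ᶜ?_ = ×-decidable ℕ._≟_ ℕ._<?_ ℕ._<?_

module _ {n : ℕ} (r : Vec ℕ n) where

  -- (k , c) stands for the letter k+1 with color c+1, so that letters range
  -- over 1, …, n and the colors of a letter over 1, …, r of that letter.
  ColoredLetter : Set
  ColoredLetter = Σ (Fin n) (λ k → Fin (lookup r k))

  coloredLetters : List ColoredLetter
  coloredLetters = concatMap (λ k → map (k ,_) (allFin (lookup r k))) (allFin n)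

  Word : ℕ → Set
  Word = Vec ColoredLetter

  words : ∀ l → List (Word l)
  words zero    = [] ∷ []
  words (suc l) = concatMap (λ x → map (x ∷_) (words l)) coloredLetters

  IsColoredPermutation : (m : Vec ℕ n) → Unary.Pred (Word (Vec.sum m)) 0ℓ
  IsColoredPermutation m w =
    ∀ k → count (λ x → proj₁ x Fin.≟ k) w ≡ lookup m k

  isColoredPermutation? : ∀ m → Unary.Decidable (IsColoredPermutation m)
  isColoredPermutation? m w = Fin.all? (λ k → _ ℕ.≟ _)

  coloredPermutations : (m : Vec ℕ n) → List (Word (Vec.sum m))
  coloredPermutations m = filter (isColoredPermutation? m) (words (Vec.sum m))

module _ {n : ℕ} where

  -- Series in the variables z₁, …, zₙ and z_{m+1}; the latter comes first.

  z : Fin n → PowerSeries (suc n)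
  z k = var (suc k)

  zₘ₊₁ : PowerSeries (suc n)
  zₘ₊₁ = var zero

module _ {n : ℕ} (r : Vec ℕ n) where

  toColoredInteger : ColoredLetter r → ColoredInteger
  toColoredInteger (k , c) = suc (toℕ c) , suc (toℕ k)

  -- The word followed by the letter n+1 of color 1.
  extend : ∀ {l} → Word r l → Vec ColoredInteger (suc l)
  extend w = Vec.map toColoredInteger w ∷ʳ (1 , suc n)

  -- Positions are counted from 0: j : Fin l is the position j+1.
  IsDescent : ∀ {l} → Word r l → Unary.Pred (Fin l) 0ℓ
  IsDescent w j = lookup (extend w) (suc j) <ᶜ lookup (extend w) (inject₁ j)

  isDescent? : ∀ {l} (w : Word r l) → Unary.Decidable (IsDescent w)
  isDescent? w j = lookup (extend w) (suc j) <ᶜ? lookup (extend w) (inject₁ j)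

  DES : ∀ {l} → Word r l → List (Fin l)
  DES w = filter (isDescent? w) (allFin _)

  -- z_{πᵢ}^{r_{πᵢ}} ⋯ z_{πₘ}^{r_{πₘ}} z_{m+1}, with i again counted from 0.
  tailMonomial : ∀ {l} → Word r l → Fin (suc l) → PowerSeries (suc n)
  tailMonomial w i =
    (∏[ x ∈ drop (toℕ i) (toList w) ] (z (proj₁ x) ^ lookup r (proj₁ x))) * zₘ₊₁

  -- The i with i - 1 a descent are the suc j with j a descent.
  summand : ∀ {l} → Word r l → PowerSeries (suc n)
  summand {l} w =
      (∏[ x ∈ toList w ] (z (proj₁ x) ^ toℕ (proj₂ x)))
    * (∏[ j ∈ DES w ] tailMonomial w (suc j))
    / (∏[ i ∈ allFin (suc l) ] (1# - tailMonomial w i))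

{-# OPTIONS --safe #-}
module Submission where

-- Expanding the geometric series, the coefficient of z_{m+1}^t on the left enumerates the colored words with
-- values 0 ≤ s₁ ≤ … ≤ s_m ≤ t =: s_{m+1}, the inequality after position j being strict if j is a descent; that is,
-- the lexicographically weakly increasing sequences of pairs (s_j , π_j^{c_j}) ending in (t , (n+1)^1). Such a
-- sequence is the sorted form of a multiset, and k^c with value s has weight z_k^(r_k s + c - 1), so on the side of
-- multisets one chooses, for every k, a multiset of m_k exponents from {0, …, r_k t}; this gives the q-binomials.
--
-- Instead of a bijection, both sides are refined by a lower bound (0 , a) on the sequence. When a passes a colored
-- letter k^c, the sequences lost are those that start with (0 , k^c), i.e. z_k^(c-1) times the refinement for
-- m - e_k; when a passes (n+1)^1, only the empty word with t = 0 is lost; and when a is beyond all letters, all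
-- values decrease by one, which costs the factor ∏_k z_k^(r_k m_k) z_{m+1}. These recurrences hold on both sides and
-- determine the series modulo z_{m+1}^T for every T.

open import Algebra.Bundles using (CommutativeMonoid; CommutativeRing)
import Algebra.Properties.CommutativeSemigroup as CommutativeSemigroupProperties
import Algebra.Properties.Semiring.Exp as Exp
import Algebra.Solver.Ring.NaturalCoefficients.Default as NaturalCoefficients
open import Data.Bool.Base using (true; false; if_then_else_)
open import Data.Empty using (⊥-elim)
open import Data.Fin.Base using (Fin; zero; suc; toℕ; fromℕ<)
import Data.Fin.Properties as Fin
open import Data.Integer.Base as ℤ using (ℤ; 0ℤ; 1ℤ)
import Data.Integer.Properties as ℤ
open import Data.List.Base using (List; []; _∷_; _++_; foldr; map; concatMap; upTo; allFin; filter; drop)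
import Data.List.Properties as List
open import Data.Nat.Base as ℕ using (ℕ; zero; suc; _∸_; _<_; _≤_; z≤n; s≤s; _⊓_; pred)
import Data.Nat.Properties as ℕ
open import Data.Product.Base using (_,_; proj₁; proj₂; ∃-syntax)
open import Data.Product.Properties using (,-injectiveˡ; ,-injectiveʳ)
open import Data.Sum.Base using (_⊎_; inj₁; inj₂)
open import Data.Vec.Base as Vec using (Vec; []; _∷_; lookup; replicate; zipWith; updateAt; toList; count; head)
import Data.Vec.Properties as Vec
open import Function.Base using (_∘_; id; flip)
open import Function.Bundles using (mk⇔)
open import Level using (0ℓ; _⊔_)
open import Relation.Binary.PropositionalEquality as ≡ using (_≡_; _≢_)
open import Relation.Nullary.Decidable using (dec-true; dec-false; does-⇔; isYes≗does)
open import Relation.Nullary.Decidable.Core using (Dec; yes; no; does)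
open import Relation.Nullary.Negation.Core using (¬_)
import Relation.Unary as Unary
open import Defs using (Exponent; degree; below; PowerSeries; monomial; var; _⁻¹; ColoredInteger; ColoredLetter; coloredLetters; Word; words; toColoredInteger; extend; _<ᶜ_; _<ᶜ?_)

-- Sums over lists and over decompositions of exponents

module BigOperator {c ℓ} (M : CommutativeMonoid c ℓ) where
  open CommutativeMonoid M
  open CommutativeSemigroupProperties commutativeSemigroup using (interchange; x∙yz≈y∙xz)
  open import Relation.Binary.Reasoning.Setoid setoid

  ⨁ : ∀ {b} {B : Set b} → List B → (B → Carrier) → Carrier
  ⨁ xs f = foldr _∙_ ε (map f xs)

  module _ {b} {B : Set b} where

    ⨁-cong : ∀ (xs : List B) {f g : B → Carrier} → (∀ x → f x ≈ g x) → ⨁ xs f ≈ ⨁ xs g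
    ⨁-cong []       f≈g = refl
    ⨁-cong (x ∷ xs) f≈g = ∙-cong (f≈g x) (⨁-cong xs f≈g)

    ⨁-ε : ∀ (xs : List B) {f : B → Carrier} → (∀ x → f x ≈ ε) → ⨁ xs f ≈ ε
    ⨁-ε []       f≈ε = refl
    ⨁-ε (x ∷ xs) f≈ε = trans (∙-cong (f≈ε x) (⨁-ε xs f≈ε)) (identityˡ ε)

    ⨁-∙ : ∀ (xs : List B) (f g : B → Carrier) → ⨁ xs (λ x → f x ∙ g x) ≈ ⨁ xs f ∙ ⨁ xs g
    ⨁-∙ []       f g = sym (identityˡ ε)
    ⨁-∙ (x ∷ xs) f g = trans (∙-congˡ (⨁-∙ xs f g)) (interchange _ _ _ _)

    ⨁-++ : ∀ (xs ys : List B) (f : B → Carrier) → ⨁ (xs ++ ys) f ≈ ⨁ xs f ∙ ⨁ ys f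
    ⨁-++ []       ys f = sym (identityˡ _)
    ⨁-++ (x ∷ xs) ys f = trans (∙-congˡ (⨁-++ xs ys f)) (sym (assoc _ _ _))

    ⨁-filter : ∀ {p} {P : Unary.Pred B p} (P? : Unary.Decidable P) (xs : List B) (f : B → Carrier) →
               ⨁ (filter P? xs) f ≈ ⨁ xs (λ x → if does (P? x) then f x else ε)
    ⨁-filter P? []       f = refl
    ⨁-filter P? (x ∷ xs) f with does (P? x)
    ... | true  = ∙-congˡ (⨁-filter P? xs f)
    ... | false = trans (⨁-filter P? xs f) (sym (identityˡ _))

    module _ {a} {A : Set a} where

      ⨁-map : ∀ (h : A → B) (xs : List A) (f : B → Carrier) → ⨁ (map h xs) f ≡ ⨁ xs (f ∘ h)
      ⨁-map h xs f = ≡.cong (foldr _∙_ ε) (≡.sym (List.map-∘ xs))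

      ⨁-concatMap : ∀ (h : A → List B) (xs : List A) (f : B → Carrier) →
                    ⨁ (concatMap h xs) f ≈ ⨁ xs (λ x → ⨁ (h x) f)
      ⨁-concatMap h []       f = refl
      ⨁-concatMap h (x ∷ xs) f = trans (⨁-++ (h x) (concatMap h xs) f) (∙-congˡ (⨁-concatMap h xs f))

  ⨁-upTo : ∀ n (f : ℕ → Carrier) → ⨁ (upTo (suc n)) f ≡ f 0 ∙ ⨁ (upTo n) (f ∘ suc)
  ⨁-upTo n f = ≡.cong (λ xs → f 0 ∙ foldr _∙_ ε xs)
    (≡.trans (List.map-applyUpTo suc f n) (≡.sym (List.map-applyUpTo id (f ∘ suc) n)))

  ⨁-upTo-last : ∀ n (f : ℕ → Carrier) → ⨁ (upTo (suc n)) f ≈ ⨁ (upTo n) f ∙ f n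
  ⨁-upTo-last zero    f = comm _ _
  ⨁-upTo-last (suc n) f = begin
    ⨁ (upTo (suc (suc n))) f                 ≡⟨ ⨁-upTo (suc n) f ⟩
    f 0 ∙ ⨁ (upTo (suc n)) (f ∘ suc)         ≈⟨ ∙-congˡ (⨁-upTo-last n (f ∘ suc)) ⟩
    f 0 ∙ (⨁ (upTo n) (f ∘ suc) ∙ f (suc n)) ≈⟨ assoc _ _ _ ⟨
    f 0 ∙ ⨁ (upTo n) (f ∘ suc) ∙ f (suc n)   ≡⟨ ≡.cong (_∙ f (suc n)) (⨁-upTo n f) ⟨
    ⨁ (upTo (suc n)) f ∙ f (suc n)           ∎

  ⨁-allFin : ∀ n (f : Fin (suc n) → Carrier) → ⨁ (allFin (suc n)) f ≡ f zero ∙ ⨁ (allFin n) (f ∘ suc)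
  ⨁-allFin n f = ≡.cong (λ xs → f zero ∙ foldr _∙_ ε xs)
    (≡.trans (List.map-tabulate suc f) (≡.sym (List.map-tabulate id (f ∘ suc))))

  ⨁-filter-allFin : ∀ {n p} {P : Unary.Pred (Fin (suc n)) p} {Q : Unary.Pred (Fin n) p}
                    (P? : Unary.Decidable P) (Q? : Unary.Decidable Q) → (∀ i → does (P? (suc i)) ≡ does (Q? i)) →
                    ∀ f → ⨁ (filter P? (allFin (suc n))) f ≈
                          (if does (P? zero) then f zero else ε) ∙ ⨁ (filter Q? (allFin n)) (f ∘ suc)
  ⨁-filter-allFin {n} P? Q? P≡Q f = begin
    ⨁ (filter P? (allFin (suc n))) f
      ≈⟨ ⨁-filter P? (allFin (suc n)) f ⟩
    ⨁ (allFin (suc n)) (λ i → if does (P? i) then f i else ε)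
      ≡⟨ ⨁-allFin n _ ⟩
    f₀ ∙ ⨁ (allFin n) (λ i → if does (P? (suc i)) then f (suc i) else ε)
      ≈⟨ ∙-congˡ (⨁-cong (allFin n) (λ i → reflexive (≡.cong (λ b → if b then f (suc i) else ε) (P≡Q i)))) ⟩
    f₀ ∙ ⨁ (allFin n) (λ i → if does (Q? i) then f (suc i) else ε)
      ≈⟨ ∙-congˡ (⨁-filter Q? (allFin n) (f ∘ suc)) ⟨
    f₀ ∙ ⨁ (filter Q? (allFin n)) (f ∘ suc)
      ∎
    where f₀ = if does (P? zero) then f zero else ε

  -- The list `js` is chosen before `f`, so that one list serves all the functions compared in
  -- `∑-differ` and `∏-differ`.
  ⨁-allFin-remove : ∀ {n} (i : Fin n) → ∃[ js ] ((∀ f → ⨁ (allFin n) f ≈ f i ∙ ⨁ js (f ∘ proj₁ {B = _≢ i})))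
  ⨁-allFin-remove {suc n} zero    = map (λ j → suc j , λ ()) (allFin n) , λ f →
    reflexive (≡.trans (⨁-allFin n f) (≡.cong (f zero ∙_) (≡.sym (⨁-map _ (allFin n) _))))
  ⨁-allFin-remove {suc n} (suc i) with js , eq ← ⨁-allFin-remove i =
    (zero , λ ()) ∷ map (λ (j , j≢i) → suc j , λ { ≡.refl → j≢i ≡.refl }) js , λ f → begin
      ⨁ (allFin (suc n)) f                                      ≡⟨ ⨁-allFin n f ⟩
      f zero ∙ ⨁ (allFin n) (f ∘ suc)                           ≈⟨ ∙-congˡ (eq (f ∘ suc)) ⟩
      f zero ∙ (f (suc i) ∙ ⨁ js (f ∘ suc ∘ proj₁))             ≈⟨ x∙yz≈y∙xz _ _ _ ⟩
      f (suc i) ∙ (f zero ∙ ⨁ js (f ∘ suc ∘ proj₁))             ≡⟨ ≡.cong (λ s → f (suc i) ∙ (f zero ∙ s)) (⨁-map _ js _) ⟨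
      _                                                         ∎

  -- Sums over all decompositions α = β + γ.

  conv₁ : ℕ → (ℕ → ℕ → Carrier) → Carrier
  conv₁ zero    F = F 0 0
  conv₁ (suc a) F = F 0 (suc a) ∙ conv₁ a (F ∘ suc)

  conv : ∀ {d} → Exponent d → (Exponent d → Exponent d → Carrier) → Carrier
  conv []      F = F [] []
  conv (a ∷ α) F = conv₁ a (λ b c → conv α (λ β γ → F (b ∷ β) (c ∷ γ)))

  conv₁-cong : ∀ a {F G : ℕ → ℕ → Carrier} → (∀ b c → b ℕ.+ c ≡ a → F b c ≈ G b c) → conv₁ a F ≈ conv₁ a G
  conv₁-cong zero    F≈G = F≈G 0 0 ≡.refl
  conv₁-cong (suc a) F≈G = ∙-cong (F≈G 0 (suc a) ≡.refl) (conv₁-cong a (λ b c eq → F≈G (suc b) c (≡.cong suc eq)))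

  conv-cong : ∀ {d} (α : Exponent d) {F G : Exponent d → Exponent d → Carrier} →
              (∀ β γ → zipWith ℕ._+_ β γ ≡ α → F β γ ≈ G β γ) → conv α F ≈ conv α G
  conv-cong []      F≈G = F≈G [] [] ≡.refl
  conv-cong (a ∷ α) F≈G = conv₁-cong a (λ b c eq → conv-cong α (λ β γ eqs → F≈G _ _ (≡.cong₂ _∷_ eq eqs)))

  conv₁-ε : ∀ a → conv₁ a (λ _ _ → ε) ≈ ε
  conv₁-ε zero    = refl
  conv₁-ε (suc a) = trans (identityˡ _) (conv₁-ε a)

  conv-ε : ∀ {d} (α : Exponent d) → conv α (λ _ _ → ε) ≈ ε
  conv-ε []      = refl
  conv-ε (a ∷ α) = trans (conv₁-cong a (λ _ _ _ → conv-ε α)) (conv₁-ε a)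

  conv₁-∙ : ∀ a (F G : ℕ → ℕ → Carrier) → conv₁ a (λ b c → F b c ∙ G b c) ≈ conv₁ a F ∙ conv₁ a G
  conv₁-∙ zero    F G = refl
  conv₁-∙ (suc a) F G = trans (∙-congˡ (conv₁-∙ a (F ∘ suc) (G ∘ suc))) (interchange _ _ _ _)

  conv-∙ : ∀ {d} (α : Exponent d) (F G : Exponent d → Exponent d → Carrier) →
           conv α (λ β γ → F β γ ∙ G β γ) ≈ conv α F ∙ conv α G
  conv-∙ []      F G = refl
  conv-∙ (a ∷ α) F G = trans (conv₁-cong a (λ _ _ _ → conv-∙ α _ _)) (conv₁-∙ a _ _)

  conv-conv₁ : ∀ {d} (α : Exponent d) a (F : Exponent d → Exponent d → ℕ → ℕ → Carrier) →
               conv α (λ β γ → conv₁ a (F β γ)) ≈ conv₁ a (λ b c → conv α (λ β γ → F β γ b c))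
  conv-conv₁ α zero    F = refl
  conv-conv₁ α (suc a) F = trans (conv-∙ α _ _) (∙-congˡ (conv-conv₁ α a _))

  conv₁-last : ∀ a (F : ℕ → ℕ → Carrier) → conv₁ (suc a) F ≈ conv₁ a (λ b c → F b (suc c)) ∙ F (suc a) 0
  conv₁-last zero    F = refl
  conv₁-last (suc a) F = trans (∙-congˡ (conv₁-last a (F ∘ suc))) (sym (assoc _ _ _))

  conv₁-comm : ∀ a (F : ℕ → ℕ → Carrier) → conv₁ a F ≈ conv₁ a (flip F)
  conv₁-comm zero    F = refl
  conv₁-comm (suc a) F = trans (conv₁-last a F) (trans (∙-congʳ (conv₁-comm a _)) (comm _ _))

  conv-comm : ∀ {d} (α : Exponent d) (F : Exponent d → Exponent d → Carrier) → conv α F ≈ conv α (flip F)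
  conv-comm []      F = refl
  conv-comm (a ∷ α) F = trans (conv₁-comm a _) (conv₁-cong a (λ _ _ _ → conv-comm α _))

  -- Both sides run over b₁ + b₂ + c = a. The terms with first index 0 form `conv₁ (suc a) (F 0)`;
  -- the others are the same sums for `F ∘ suc`.
  conv₁-assoc : ∀ a (F : ℕ → ℕ → ℕ → Carrier) →
                conv₁ a (λ b c → conv₁ b (λ b₁ b₂ → F b₁ b₂ c)) ≈ conv₁ a (λ b c → conv₁ c (λ c₁ c₂ → F b c₁ c₂))
  conv₁-assoc zero    F = refl
  conv₁-assoc (suc a) F = begin
    F 0 0 (suc a) ∙ conv₁ a (λ b c → F 0 (suc b) c ∙ conv₁ b (λ b₁ b₂ → F (suc b₁) b₂ c))
      ≈⟨ ∙-congˡ (conv₁-∙ a _ _) ⟩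
    F 0 0 (suc a) ∙ (conv₁ a (λ b c → F 0 (suc b) c) ∙ conv₁ a (λ b c → conv₁ b (λ b₁ b₂ → F (suc b₁) b₂ c)))
      ≈⟨ assoc _ _ _ ⟨
    conv₁ (suc a) (F 0) ∙ conv₁ a (λ b c → conv₁ b (λ b₁ b₂ → F (suc b₁) b₂ c))
      ≈⟨ ∙-congˡ (conv₁-assoc a (F ∘ suc)) ⟩
    conv₁ (suc a) (F 0) ∙ conv₁ a (λ b c → conv₁ c (F (suc b)))
      ∎

  conv-assoc : ∀ {d} (α : Exponent d) (F : Exponent d → Exponent d → Exponent d → Carrier) →
               conv α (λ β γ → conv β (λ β₁ β₂ → F β₁ β₂ γ)) ≈ conv α (λ β γ → conv γ (λ γ₁ γ₂ → F β γ₁ γ₂))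
  conv-assoc []      F = refl
  conv-assoc (a ∷ α) F = begin
    conv₁ a (λ b c → conv α (λ β γ → conv₁ b (λ b₁ b₂ → conv β (λ β₁ β₂ → F (b₁ ∷ β₁) (b₂ ∷ β₂) (c ∷ γ)))))
      ≈⟨ conv₁-cong a (λ b c _ → conv-conv₁ α b _) ⟩
    conv₁ a (λ b c → conv₁ b (λ b₁ b₂ → conv α (λ β γ → conv β (λ β₁ β₂ → F (b₁ ∷ β₁) (b₂ ∷ β₂) (c ∷ γ)))))
      ≈⟨ conv₁-assoc a _ ⟩
    conv₁ a (λ b c → conv₁ c (λ c₁ c₂ → conv α (λ β γ → conv β (λ β₁ β₂ → F (b ∷ β₁) (c₁ ∷ β₂) (c₂ ∷ γ)))))
      ≈⟨ conv₁-cong a (λ b c _ → conv₁-cong c (λ _ _ _ → conv-assoc α _)) ⟩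
    conv₁ a (λ b c → conv₁ c (λ c₁ c₂ → conv α (λ β γ → conv γ (λ γ₁ γ₂ → F (b ∷ β) (c₁ ∷ γ₁) (c₂ ∷ γ₂)))))
      ≈⟨ conv₁-cong a (λ b c _ → conv-conv₁ α c _) ⟨
    conv₁ a (λ b c → conv α (λ β γ → conv₁ c (λ c₁ c₂ → conv γ (λ γ₁ γ₂ → F (b ∷ β) (c₁ ∷ γ₁) (c₂ ∷ γ₂)))))
      ∎

  conv₁-upTo : ∀ a (F : ℕ → ℕ → Carrier) → ⨁ (upTo (suc a)) (λ b → F b (a ∸ b)) ≈ conv₁ a F
  conv₁-upTo zero    F = identityʳ _
  conv₁-upTo (suc a) F = trans (reflexive (⨁-upTo (suc a) _)) (∙-congˡ (conv₁-upTo a (F ∘ suc)))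

  -- For β ≤ α the truncated difference is the actual one, so the product of power series becomes a
  -- recursive sum that is symmetric in both exponents.
  conv-below : ∀ {d} (α : Exponent d) (F : Exponent d → Exponent d → Carrier) →
               ⨁ (below α) (λ β → F β (zipWith _∸_ α β)) ≈ conv α F
  conv-below []      F = identityʳ _
  conv-below (a ∷ α) F = begin
    ⨁ (below (a ∷ α)) (λ β → F β (zipWith _∸_ (a ∷ α) β))
      ≈⟨ ⨁-concatMap (λ b → map (b ∷_) (below α)) (upTo (suc a)) _ ⟩
    ⨁ (upTo (suc a)) (λ b → ⨁ (map (b ∷_) (below α)) (λ β → F β (zipWith _∸_ (a ∷ α) β)))
      ≈⟨ ⨁-cong (upTo (suc a)) (λ b → trans (reflexive (⨁-map (b ∷_) (below α) _)) (conv-below α (λ β γ → F (b ∷ β) (a ∸ b ∷ γ)))) ⟩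
    ⨁ (upTo (suc a)) (λ b → conv α (λ β γ → F (b ∷ β) (a ∸ b ∷ γ)))
      ≈⟨ conv₁-upTo a _ ⟩
    conv (a ∷ α) F
      ∎

-- The ring of power series

module ℤ-sum = BigOperator ℤ.+-0-commutativeMonoid
open ℤ-sum using (conv₁; conv)

conv₁-*ˡ : ∀ a x F → x ℤ.* conv₁ a F ≡ conv₁ a (λ b c → x ℤ.* F b c)
conv₁-*ˡ zero    x F = ≡.refl
conv₁-*ˡ (suc a) x F = ≡.trans (ℤ.*-distribˡ-+ x _ _) (≡.cong (λ y → x ℤ.* F 0 (suc a) ℤ.+ y) (conv₁-*ˡ a x _))

conv-*ˡ : ∀ {d} (α : Exponent d) x F → x ℤ.* conv α F ≡ conv α (λ β γ → x ℤ.* F β γ)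
conv-*ˡ []      x F = ≡.refl
conv-*ˡ (a ∷ α) x F = ≡.trans (conv₁-*ˡ a x _) (ℤ-sum.conv₁-cong a (λ _ _ _ → conv-*ˡ α x _))

conv-*ʳ : ∀ {d} (α : Exponent d) F x → conv α F ℤ.* x ≡ conv α (λ β γ → F β γ ℤ.* x)
conv-*ʳ α F x = ≡.trans (ℤ.*-comm _ x) (≡.trans (conv-*ˡ α x F) (ℤ-sum.conv-cong α (λ _ _ _ → ℤ.*-comm x _)))

zeros : ∀ {d} → Exponent d
zeros = replicate _ 0

conv₁-zero : ∀ a (F : ℕ → ℕ → ℤ) → (∀ b c → F (suc b) c ≡ 0ℤ) → conv₁ a F ≡ F 0 a
conv₁-zero zero    F F≡0 = ≡.refl
conv₁-zero (suc a) F F≡0 =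
  ≡.trans (≡.cong (λ y → F 0 (suc a) ℤ.+ y) (≡.trans (ℤ-sum.conv₁-cong a (λ b c _ → F≡0 b c)) (ℤ-sum.conv₁-ε a))) (ℤ.+-identityʳ _)

-- ⌊_⌋ inspects the whole decision, whereas does computes through the decision procedure for vectors.
monomial-does : ∀ {d} (α β : Exponent d) → monomial α β ≡ (if does (Vec.≡-dec ℕ._≟_ α β) then 1ℤ else 0ℤ)
monomial-does α β = ≡.cong (λ b → if b then 1ℤ else 0ℤ) (isYes≗does (Vec.≡-dec ℕ._≟_ α β))

monomial-0∷ : ∀ {d} (α β : Exponent d) → monomial (0 ∷ α) (0 ∷ β) ≡ monomial α β
monomial-0∷ α β = ≡.trans (monomial-does (0 ∷ α) (0 ∷ β)) (≡.sym (monomial-does α β))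

conv-1# : ∀ {d} (α : Exponent d) (f : PowerSeries d) → conv α (λ β γ → monomial zeros β ℤ.* f γ) ≡ f α
conv-1# []      f = ℤ.*-identityˡ _
conv-1# (a ∷ α) f = ≡.trans
  (conv₁-zero a _ (λ b c → ≡.trans (ℤ-sum.conv-cong α (λ β γ _ → ℤ.*-zeroˡ (f (c ∷ γ)))) (ℤ-sum.conv-ε α)))
  (≡.trans (ℤ-sum.conv-cong α (λ β γ _ → ≡.cong (ℤ._* f (a ∷ γ)) (monomial-0∷ zeros β)))
    (conv-1# α (λ γ → f (a ∷ γ))))

module Arithmetic (d : ℕ) where
  open Defs using (_≈_; _+_; _*_; -_; 0#; 1#)
  open import Algebra.Definitions (_≈_ {d})

  *-conv : ∀ (f g : PowerSeries d) α → (f * g) α ≡ conv α (λ β γ → f β ℤ.* g γ)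
  *-conv f g α = ℤ-sum.conv-below α _

  *-cong : Congruent₂ _*_
  *-cong {f} {f′} {g} {g′} f≈f′ g≈g′ α = ≡.trans (*-conv f g α)
    (≡.trans (ℤ-sum.conv-cong α (λ β γ _ → ≡.cong₂ ℤ._*_ (f≈f′ β) (g≈g′ γ))) (≡.sym (*-conv f′ g′ α)))

  *-comm : Commutative _*_
  *-comm f g α = ≡.trans (*-conv f g α) (≡.trans (ℤ-sum.conv-comm α _)
    (≡.trans (ℤ-sum.conv-cong α (λ β γ _ → ℤ.*-comm (f γ) (g β))) (≡.sym (*-conv g f α))))

  *-assoc : Associative _*_
  *-assoc f g h α = begin
    ((f * g) * h) α
      ≡⟨ *-conv (f * g) h α ⟩
    conv α (λ β γ → (f * g) β ℤ.* h γ)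
      ≡⟨ ℤ-sum.conv-cong α (λ β γ _ → ≡.trans (≡.cong (ℤ._* h γ) (*-conv f g β)) (conv-*ʳ β _ (h γ))) ⟩
    conv α (λ β γ → conv β (λ β₁ β₂ → f β₁ ℤ.* g β₂ ℤ.* h γ))
      ≡⟨ ℤ-sum.conv-assoc α _ ⟩
    conv α (λ β γ → conv γ (λ γ₁ γ₂ → f β ℤ.* g γ₁ ℤ.* h γ₂))
      ≡⟨ ℤ-sum.conv-cong α (λ β γ _ → ≡.trans (≡.cong (f β ℤ.*_) (*-conv g h γ))
           (≡.trans (conv-*ˡ γ (f β) _) (ℤ-sum.conv-cong γ (λ γ₁ γ₂ _ → ≡.sym (ℤ.*-assoc (f β) (g γ₁) (h γ₂)))))) ⟨
    conv α (λ β γ → f β ℤ.* (g * h) γ)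
      ≡⟨ *-conv f (g * h) α ⟨
    (f * (g * h)) α
      ∎
    where open ≡.≡-Reasoning

  *-identityˡ : LeftIdentity 1# _*_
  *-identityˡ f α = ≡.trans (*-conv 1# f α) (conv-1# α f)

  *-distribˡ-+ : _*_ DistributesOverˡ _+_
  *-distribˡ-+ f g h α = begin
    (f * (g + h)) α
      ≡⟨ *-conv f (g + h) α ⟩
    conv α (λ β γ → f β ℤ.* (g γ ℤ.+ h γ))
      ≡⟨ ℤ-sum.conv-cong α (λ β γ _ → ℤ.*-distribˡ-+ (f β) (g γ) (h γ)) ⟩
    conv α (λ β γ → f β ℤ.* g γ ℤ.+ f β ℤ.* h γ)
      ≡⟨ ℤ-sum.conv-∙ α _ _ ⟩
    conv α (λ β γ → f β ℤ.* g γ) ℤ.+ conv α (λ β γ → f β ℤ.* h γ)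
      ≡⟨ ≡.cong₂ ℤ._+_ (*-conv f g α) (*-conv f h α) ⟨
    (f * g + f * h) α
      ∎
    where open ≡.≡-Reasoning

  powerSeriesRing : CommutativeRing 0ℓ 0ℓ
  powerSeriesRing = record
    { Carrier = PowerSeries d
    ; _≈_ = _≈_
    ; _+_ = _+_
    ; _*_ = _*_
    ; -_  = -_
    ; 0#  = 0#
    ; 1#  = 1#
    ; isCommutativeRing = record
      { isRing = record
        { +-isAbelianGroup = record
          { isGroup = record
            { isMonoid = record
              { isSemigroup = record
                { isMagma = record
                  { isEquivalence = record
                    { refl  = λ _ → ≡.refl
                    ; sym   = λ eq α → ≡.sym (eq α)
                    ; trans = λ eq eq′ α → ≡.trans (eq α) (eq′ α)
                    }
                  ; ∙-cong = λ eq eq′ α → ≡.cong₂ ℤ._+_ (eq α) (eq′ α)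
                  }
                ; assoc = λ f g h α → ℤ.+-assoc (f α) (g α) (h α)
                }
              ; identity = (λ f α → ℤ.+-identityˡ (f α)) , (λ f α → ℤ.+-identityʳ (f α))
              }
            ; inverse = (λ f α → ℤ.+-inverseˡ (f α)) , (λ f α → ℤ.+-inverseʳ (f α))
            ; ⁻¹-cong = λ eq α → ≡.cong ℤ.-_ (eq α)
            }
          ; comm = λ f g α → ℤ.+-comm (f α) (g α)
          }
        ; *-cong     = λ {f} {f′} {g} {g′} → *-cong {f} {f′} {g} {g′}
        ; *-assoc    = *-assoc
        ; *-identity = *-identityˡ , λ f α → ≡.trans (*-comm f 1# α) (*-identityˡ f α)
        ; distrib    = *-distribˡ-+ , λ f g h α → ≡.trans (*-comm (g + h) f α)
            (≡.trans (*-distribˡ-+ f g h α) (≡.cong₂ ℤ._+_ (*-comm f g α) (*-comm f h α)))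
        }
      ; *-comm = *-comm
      }
    }

open Arithmetic using (powerSeriesRing; *-conv)

-- Orders and inverses of power series

module GeometricSum {c ℓ} (R : CommutativeRing c ℓ) where
  open CommutativeRing R
  open Exp semiring using (_^_)
  open BigOperator +-commutativeMonoid using (⨁; ⨁-upTo-last)
  open NaturalCoefficients commutativeSemiring using (solve; _:+_; _:*_; _:=_)
  open import Relation.Binary.Reasoning.Setoid setoid

  1-x+x : ∀ x → 1# - x + x ≈ 1#
  1-x+x x = trans (+-assoc _ _ _) (trans (+-congˡ (-‿inverseˡ x)) (+-identityʳ _))

  -- The sum telescopes. With `f` in place of 1 - x and the remainder on the left no negation
  -- occurs, so the semiring solver applies.
  geometricSum : ∀ {f x} → f + x ≈ 1# → ∀ N → f * ⨁ (upTo N) (x ^_) + x ^ N ≈ 1#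
  geometricSum {f} {x} f+x≈1 zero    = trans (+-congʳ (zeroʳ f)) (+-identityˡ 1#)
  geometricSum {f} {x} f+x≈1 (suc N) = begin
    f * ⨁ (upTo (suc N)) (x ^_) + x * x ^ N   ≈⟨ +-congʳ (*-congˡ (⨁-upTo-last N (x ^_))) ⟩
    f * (S + x ^ N) + x * x ^ N               ≈⟨ solve 4 (λ f x S p → f :* (S :+ p) :+ x :* p := f :* S :+ (f :+ x) :* p) refl f x S (x ^ N) ⟩
    f * S + (f + x) * x ^ N                   ≈⟨ +-congˡ (trans (*-congʳ f+x≈1) (*-identityˡ _)) ⟩
    f * S + x ^ N                             ≈⟨ geometricSum f+x≈1 N ⟩
    1#                                        ∎
    where S = ⨁ (upTo N) (x ^_)

degree-+ : ∀ {d} (β γ : Exponent d) → degree (zipWith ℕ._+_ β γ) ≡ degree β ℕ.+ degree γ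
degree-+ []      []      = ≡.refl
degree-+ (b ∷ β) (c ∷ γ) = ≡.trans (≡.cong (b ℕ.+ c ℕ.+_) (degree-+ β γ)) (interchange b c (degree β) (degree γ))
  where open import Algebra.Properties.CommutativeSemigroup ℕ.+-commutativeSemigroup using (interchange)

head-+ : ∀ {d} (β γ : Exponent (suc d)) → head (zipWith ℕ._+_ β γ) ≡ head β ℕ.+ head γ
head-+ (_ ∷ _) (_ ∷ _) = ≡.refl

degree-zeros : ∀ {d} (α : Exponent d) → degree α < 1 → α ≡ zeros
degree-zeros []         _   = ≡.refl
degree-zeros (zero ∷ α) α<1 = ≡.cong (0 ∷_) (degree-zeros α α<1)
degree-zeros (suc a ∷ α) (s≤s ())

conv-zeros : ∀ d (F : Exponent d → Exponent d → ℤ) → ℤ-sum.conv zeros F ≡ F zeros zeros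
conv-zeros zero    F = ≡.refl
conv-zeros (suc d) F = conv-zeros d _

constant-1# : ∀ d → monomial {d} zeros zeros ≡ 1ℤ
constant-1# zero    = ≡.refl
constant-1# (suc d) = ≡.trans (monomial-0∷ {d} zeros zeros) (constant-1# d)

module _ {d : ℕ} where
  open Defs using (_≈_; _+_; _*_; 1#; _-_; _^_)
  open CommutativeRing (powerSeriesRing d) using (+-commutativeMonoid)
  open BigOperator +-commutativeMonoid using (⨁; ⨁-upTo-last)

  -- `wt` is `degree` for the inverses, and `head`, the exponent of z_{m+1}, for reading off
  -- coefficients at the end.
  module Order (wt : Exponent d → ℕ) (wt-+ : ∀ β γ → wt (zipWith ℕ._+_ β γ) ≡ wt β ℕ.+ wt γ) where

    HasOrder : ℕ → PowerSeries d → Set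
    HasOrder a f = ∀ α → wt α < a → f α ≡ 0ℤ

    -- If wt β + wt γ < a + b, then wt β < a or wt γ < b, so each term of the convolution has a zero
    -- factor.
    order-* : ∀ {a b} f g → HasOrder a f → HasOrder b g → HasOrder (a ℕ.+ b) (f * g)
    order-* {a} {b} f g ord-f ord-g α α<a+b = ≡.trans (*-conv d f g α)
      (≡.trans (ℤ-sum.conv-cong α vanish) (ℤ-sum.conv-ε α))
      where
      vanish : ∀ β γ → zipWith ℕ._+_ β γ ≡ α → f β ℤ.* g γ ≡ 0ℤ
      vanish β γ ≡.refl with wt β ℕ.<? a
      ... | yes β<a = ≡.trans (≡.cong (ℤ._* g γ) (ord-f β β<a)) (ℤ.*-zeroˡ (g γ))
      ... | no  β≮a = ≡.trans (≡.cong (f β ℤ.*_) (ord-g γ γ<b)) (ℤ.*-zeroʳ (f β))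
        where
        γ<b : wt γ < b
        γ<b = ℕ.+-cancelˡ-< a (wt γ) b (ℕ.≤-<-trans (ℕ.+-monoˡ-≤ (wt γ) (ℕ.≮⇒≥ β≮a))
          (≡.subst (_< a ℕ.+ b) (wt-+ β γ) α<a+b))

    order-^ : ∀ f → HasOrder 1 f → ∀ t → HasOrder t (f ^ t)
    order-^ f ord-f zero    = λ _ ()
    order-^ f ord-f (suc t) = order-* f (f ^ t) ord-f (order-^ f ord-f t)

  open Order degree degree-+

  constant-* : ∀ (f g : PowerSeries d) → (f * g) zeros ≡ f zeros ℤ.* g zeros
  constant-* f g = ≡.trans (*-conv d f g zeros) (conv-zeros d _)

  -- `_⁻¹` truncates the geometric series at a point that depends on the exponent. Since x^N has
  -- order N, longer sums have the same coefficient, so one N can serve all the γ of a convolution.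
  ⁻¹-truncate : ∀ {x : PowerSeries d} → HasOrder 1 x → ∀ γ {N} → degree γ < N →
                ⨁ (upTo (suc (degree γ))) (x ^_) γ ≡ ⨁ (upTo N) (x ^_) γ
  ⁻¹-truncate {x} ord-x γ γ<N = go (ℕ.≤⇒≤′ γ<N)
    where
    go : ∀ {N} → suc (degree γ) ℕ.≤′ N → ⨁ (upTo (suc (degree γ))) (x ^_) γ ≡ ⨁ (upTo N) (x ^_) γ
    go ℕ.≤′-refl         = ≡.refl
    go {suc N} (ℕ.≤′-step γ<N) = ≡.trans (go γ<N) (≡.trans (≡.sym (ℤ.+-identityʳ _))
      (≡.trans (≡.cong (λ y → ⨁ (upTo N) (x ^_) γ ℤ.+ y) (≡.sym (order-^ x ord-x N γ (ℕ.≤′⇒≤ γ<N))))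
        (≡.sym (⨁-upTo-last N (x ^_) γ))))

  -- At α only γ of degree at most `degree α` occur, so `f ⁻¹` may be replaced by the fixed partial
  -- sum `S`; the remainder x^N of `geometricSum` vanishes at α.
  ⁻¹-inverseʳ : ∀ (f : PowerSeries d) → f zeros ≡ 1ℤ → f * f ⁻¹ ≈ 1#
  ⁻¹-inverseʳ f f₀≡1 α = begin
    (f * f ⁻¹) α
      ≡⟨ *-conv d f (f ⁻¹) α ⟩
    ℤ-sum.conv α (λ β γ → f β ℤ.* (f ⁻¹) γ)
      ≡⟨ ℤ-sum.conv-cong α (λ β γ β+γ≡α → ≡.cong (f β ℤ.*_) (⁻¹-truncate ord-x γ (s≤s (γ≤α β γ β+γ≡α)))) ⟩
    ℤ-sum.conv α (λ β γ → f β ℤ.* S γ)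
      ≡⟨ *-conv d f S α ⟨
    (f * S) α
      ≡⟨ ℤ.+-identityʳ _ ⟨
    (f * S) α ℤ.+ 0ℤ
      ≡⟨ ≡.cong (λ y → (f * S) α ℤ.+ y) (order-^ x ord-x N α ℕ.≤-refl) ⟨
    (f * S) α ℤ.+ (x ^ N) α
      ≡⟨ geometricSum {f} {x} f+x≈1 N α ⟩
    1# α
      ∎
    where
    open ≡.≡-Reasoning
    open GeometricSum (powerSeriesRing d)
    x S : PowerSeries d
    x = 1# - f
    N = suc (degree α)
    S = ⨁ (upTo N) (x ^_)
    f+x≈1 : f + x ≈ 1#
    f+x≈1 γ = ≡.trans (ℤ.+-comm (f γ) _) (1-x+x f γ)
    ord-x : HasOrder 1 x
    ord-x γ γ<1 rewrite degree-zeros γ γ<1 | f₀≡1 | constant-1# d = ≡.refl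
    γ≤α : ∀ β γ → zipWith ℕ._+_ β γ ≡ α → degree γ ≤ degree α
    γ≤α β γ ≡.refl = ≡.subst (degree γ ≤_) (≡.sym (degree-+ β γ)) (ℕ.m≤n+m (degree γ) (degree β))

-- The recurrences for multisets

sum≡0⇒lookup≡0 : ∀ {n} (m : Vec ℕ n) → Vec.sum m ≡ 0 → ∀ k → lookup m k ≡ 0
sum≡0⇒lookup≡0 (a ∷ m) eq zero    = ℕ.m+n≡0⇒m≡0 a eq
sum≡0⇒lookup≡0 (a ∷ m) eq (suc k) = sum≡0⇒lookup≡0 m (ℕ.m+n≡0⇒n≡0 a eq) k

sum≡suc⇒lookup≡suc : ∀ {n} (m : Vec ℕ n) {s} → Vec.sum m ≡ suc s → ∃[ k ] ∃[ M ] lookup m k ≡ suc M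
sum≡suc⇒lookup≡suc (suc a ∷ m) eq = zero , a , ≡.refl
sum≡suc⇒lookup≡suc (zero  ∷ m) eq with k , M , eq′ ← sum≡suc⇒lookup≡suc m eq = suc k , M , eq′

sum-updateAt-pred : ∀ {n} (m : Vec ℕ n) k {M s} → lookup m k ≡ suc M → Vec.sum m ≡ suc s → Vec.sum (updateAt m k pred) ≡ s
sum-updateAt-pred (suc a ∷ m) zero    _  eq = ℕ.suc-injective eq
sum-updateAt-pred (zero  ∷ m) (suc k) mk eq = sum-updateAt-pred m k mk eq
sum-updateAt-pred (suc a ∷ m) (suc k) {s = s} mk eq with sum≡s ← ℕ.suc-injective eq | Vec.sum m in sum-m
... | zero  with () ← ≡.trans (≡.sym mk) (sum≡0⇒lookup≡0 m sum-m k)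
... | suc s′ = ≡.trans (≡.cong (suc a ℕ.+_) (sum-updateAt-pred m k mk sum-m)) (≡.trans (≡.sym (ℕ.+-suc a s′)) sum≡s)

module RingSums {c ℓ} (R : CommutativeRing c ℓ) where
  open CommutativeRing R
  open import Relation.Binary.Reasoning.Setoid setoid
  open NaturalCoefficients commutativeSemiring using (solve; _:+_; _:*_; _:=_)
  module ∑ = BigOperator +-commutativeMonoid
  module ∏ = BigOperator *-commutativeMonoid
  open ∑ public using () renaming (⨁ to ∑)
  open ∏ public using () renaming (⨁ to ∏)

  ∑-*ˡ : ∀ {b} {B : Set b} (xs : List B) x (f : B → Carrier) → x * ∑ xs f ≈ ∑ xs (λ y → x * f y)
  ∑-*ˡ []       x f = zeroʳ x
  ∑-*ˡ (y ∷ xs) x f = trans (distribˡ x _ _) (+-congˡ (∑-*ˡ xs x f))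

  module _ {n} {f g : Fin n → Carrier} (k : Fin n) where

    ∑-differ : (∀ j → j ≢ k → f j ≈ g j) → ∀ {x} → f k ≈ g k + x → ∑ (allFin n) f ≈ ∑ (allFin n) g + x
    ∑-differ f≈g {x} fk with js , eq ← ∑.⨁-allFin-remove k = begin
      ∑ (allFin n) f              ≈⟨ eq f ⟩
      f k + ∑ js (f ∘ proj₁)      ≈⟨ +-cong fk (∑.⨁-cong js (λ (j , j≢k) → f≈g j j≢k)) ⟩
      g k + x + ∑ js (g ∘ proj₁)  ≈⟨ solve 3 (λ a b c → a :+ b :+ c := a :+ c :+ b) refl (g k) x _ ⟩
      g k + ∑ js (g ∘ proj₁) + x  ≈⟨ +-congʳ (eq g) ⟨
      ∑ (allFin n) g + x          ∎

    ∏-scale : (∀ j → j ≢ k → f j ≈ g j) → ∀ {x} → f k ≈ x * g k → ∏ (allFin n) f ≈ x * ∏ (allFin n) g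
    ∏-scale f≈g {x} fk with js , eq ← ∏.⨁-allFin-remove k = begin
      ∏ (allFin n) f                ≈⟨ eq f ⟩
      f k * ∏ js (f ∘ proj₁)        ≈⟨ *-cong fk (∏.⨁-cong js (λ (j , j≢k) → f≈g j j≢k)) ⟩
      x * g k * ∏ js (g ∘ proj₁)    ≈⟨ *-assoc _ _ _ ⟩
      x * (g k * ∏ js (g ∘ proj₁))  ≈⟨ *-congˡ (eq g) ⟨
      x * ∏ (allFin n) g            ∎

    -- A product is linear in its factor at `k`. In use, `g` belongs to the raised bound and `h` to
    -- the multiset with one copy of `k` removed.
    ∏-differ : ∀ {h : Fin n → Carrier} → (∀ j → j ≢ k → f j ≈ g j) → (∀ j → j ≢ k → f j ≈ h j) →
               ∀ {x} → f k ≈ g k + x * h k → ∏ (allFin n) f ≈ ∏ (allFin n) g + x * ∏ (allFin n) h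
    ∏-differ {h} f≈g f≈h {x} fk with js , eq ← ∏.⨁-allFin-remove k = begin
      ∏ (allFin n) f                                               ≈⟨ eq f ⟩
      f k * F                                                      ≈⟨ *-congʳ fk ⟩
      (g k + x * h k) * F                                          ≈⟨ solve 4 (λ a x b c → (a :+ x :* b) :* c := a :* c :+ x :* (b :* c)) refl (g k) x (h k) F ⟩
      g k * F + x * (h k * F)                                      ≈⟨ +-cong (*-congˡ (∏.⨁-cong js (λ (j , j≢k) → f≈g j j≢k)))
                                                                        (*-congˡ (*-congˡ (∏.⨁-cong js (λ (j , j≢k) → f≈h j j≢k)))) ⟩
      g k * ∏ js (g ∘ proj₁) + x * (h k * ∏ js (h ∘ proj₁))        ≈⟨ +-cong (eq g) (*-congˡ (eq h)) ⟨
      ∏ (allFin n) g + x * ∏ (allFin n) h                          ∎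
      where F = ∏ js (f ∘ proj₁)

  ∏-zero : ∀ {n} {f : Fin n → Carrier} (k : Fin n) → f k ≈ 0# → ∏ (allFin n) f ≈ 0#
  ∏-zero {f = f} k fk with js , eq ← ∏.⨁-allFin-remove k = trans (eq f) (trans (*-congʳ fk) (zeroˡ _))

module Multisets {a ℓ} (R : CommutativeRing a ℓ) where
  open CommutativeRing R
  open Exp semiring using (_^_)

  -- The complete homogeneous symmetric polynomial of degree M in 1, q, …, q^(l-1).
  h : Carrier → ℕ → ℕ → Carrier
  h q l       zero    = 1#
  h q zero    (suc M) = 0#
  h q (suc l) (suc M) = q ^ suc M * h q l (suc M) + h q (suc l) M

module MultisetSide {a ℓ} (R : CommutativeRing a ℓ) {n} (r : Vec ℕ n) (1≤r : ∀ k → 1 ≤ lookup r k)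
  (z : Fin n → CommutativeRing.Carrier R) (w : CommutativeRing.Carrier R) where
  open CommutativeRing R hiding (zero)
  open import Relation.Binary.Reasoning.Setoid setoid
  open Exp semiring using (_^_; ^-congʳ; ^-homo-*)
  open RingSums R
  open Multisets R
  open NaturalCoefficients commutativeSemiring using (solve; _:+_; _:*_; _:=_)

  -- A bound a = (k+1)^(c+1) is encoded by c and k; for k = n and c = 0 it is the appended letter (n+1)^1.
  -- J i c k is the number of colors in which the letter i+1 lies below the bound.
  J : Fin n → ℕ → ℕ → ℕ
  J i c k = lookup r i ⊓ (if does (toℕ i ℕ.<? k) then suc c else c)

  -- The multisets of M exponents of z i taken from {j, …, r_i t}.
  g : ℕ → Fin n → ℕ → ℕ → Carrier
  g t i j M = z i ^ (j ℕ.* M) * h (z i) (suc (lookup r i ℕ.* t) ∸ j) M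

  -- For t = 0 the sequence contains (0 , (n+1)^1), hence has no lower bound of a color above 1.
  δ : ℕ → ℕ → Carrier
  δ zero    (suc _) = 0#
  δ zero    zero    = 1#
  δ (suc _) _       = 1#

  -- A letter i of color c' with value s has exponent r_i s + c' - 1, so the bound (0 , a) excludes
  -- precisely the first `J` exponents of each letter; `δ` imposes the bound on the appended letter.
  G : ℕ → ℕ → ℕ → Vec ℕ n → Carrier
  G t c k m = δ t c * ∏ (allFin n) (λ i → g t i (J i c k) (lookup m i))

  g-zero : ∀ t i j → g t i j 0 ≈ 1#
  g-zero t i j = trans (*-congʳ (^-congʳ (z i) (ℕ.*-zeroʳ j))) (*-identityʳ 1#)

  -- A multiset from {j, ..., r_i t} either avoids j or arises by adding j to a smaller one. This is
  -- the recursion of `h` after a shift by j.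
  g-suc : ∀ t i j M → j ≤ lookup r i ℕ.* t → g t i j (suc M) ≈ g t i (suc j) (suc M) + z i ^ j * g t i j M
  g-suc t i j M j≤rt = begin
    q ^ (j ℕ.* suc M) * h q (suc (lookup r i ℕ.* t) ∸ j) (suc M)
      ≡⟨ ≡.cong (λ l → q ^ (j ℕ.* suc M) * h q l (suc M)) l≡ ⟩
    q ^ (j ℕ.* suc M) * (q ^ suc M * h q L (suc M) + h q (suc L) M)
      ≈⟨ solve 4 (λ a b c d → a :* (b :* c :+ d) := b :* a :* c :+ a :* d) refl (q ^ (j ℕ.* suc M)) (q ^ suc M) _ _ ⟩
    q ^ suc M * q ^ (j ℕ.* suc M) * h q L (suc M) + q ^ (j ℕ.* suc M) * h q (suc L) M
      ≈⟨ +-cong (*-congʳ (sym (^-homo-* q (suc M) (j ℕ.* suc M))))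
           (*-congʳ (trans (^-congʳ q (ℕ.*-suc j M)) (^-homo-* q j (j ℕ.* M)))) ⟩
    q ^ (suc j ℕ.* suc M) * h q L (suc M) + q ^ j * q ^ (j ℕ.* M) * h q (suc L) M
      ≈⟨ +-congˡ (*-assoc _ _ _) ⟩
    q ^ (suc j ℕ.* suc M) * h q L (suc M) + q ^ j * (q ^ (j ℕ.* M) * h q (suc L) M)
      ≡⟨ ≡.cong (λ l → q ^ (suc j ℕ.* suc M) * h q L (suc M) + q ^ j * (q ^ (j ℕ.* M) * h q l M)) l≡ ⟨
    g t i (suc j) (suc M) + q ^ j * g t i j M
      ∎
    where
    q = z i
    L = lookup r i ℕ.* t ∸ j
    l≡ : suc (lookup r i ℕ.* t) ∸ j ≡ suc L
    l≡ = ℕ.+-∸-assoc 1 j≤rt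

  J-other : ∀ {i k} c → i ≢ k → J i c (toℕ k) ≡ J i c (suc (toℕ k))
  J-other {i} {k} c i≢k = ≡.cong (λ b → lookup r i ⊓ (if b then suc c else c))
    (does-⇔ (mk⇔ ℕ.m<n⇒m<1+n (λ i<1+k → ℕ.≤∧≢⇒< (ℕ.≤-pred i<1+k) (i≢k ∘ Fin.toℕ-injective))) (_ ℕ.<? _) (_ ℕ.<? _))

  J-before : ∀ k c → J k c (toℕ k) ≡ lookup r k ⊓ c
  J-before k c rewrite dec-false (toℕ k ℕ.<? toℕ k) (ℕ.<-irrefl ≡.refl) = ≡.refl

  J-after : ∀ k c → J k c (suc (toℕ k)) ≡ lookup r k ⊓ suc c
  J-after k c rewrite dec-true (toℕ k ℕ.<? suc (toℕ k)) ℕ.≤-refl = ≡.refl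

  J-last : ∀ k c → J k c n ≡ lookup r k ⊓ suc c
  J-last k c rewrite dec-true (toℕ k ℕ.<? n) (Fin.toℕ<n k) = ≡.refl

  -- For multiplicity 0 the factor is 1 whatever the bound, so `J` may change there.
  G-cong : ∀ t c k k′ m → (∀ i → J i c k ≡ J i c k′ ⊎ lookup m i ≡ 0) → G t c k m ≈ G t c k′ m
  G-cong t c k k′ m same = *-congˡ {δ t c} (∏.⨁-cong (allFin n) eq)
    where
    eq : ∀ i → g t i (J i c k) (lookup m i) ≈ g t i (J i c k′) (lookup m i)
    eq i with same i
    ... | inj₁ J≡ = reflexive (≡.cong (λ j → g t i j (lookup m i)) J≡)
    ... | inj₂ m≡0 rewrite m≡0 = trans (g-zero t i (J i c k)) (sym (g-zero t i (J i c k′)))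

  G-absent : ∀ t c k m → lookup m k ≡ 0 → G t c (toℕ k) m ≈ G t c (suc (toℕ k)) m
  G-absent t c k m m≡0 = G-cong t c (toℕ k) (suc (toℕ k)) m same
    where
    same : ∀ i → J i c (toℕ k) ≡ J i c (suc (toℕ k)) ⊎ lookup m i ≡ 0
    same i with i Fin.≟ k
    ... | yes ≡.refl = inj₂ m≡0
    ... | no  i≢k    = inj₁ (J-other c i≢k)

  G-uncolored : ∀ t c k m → lookup r k ≤ c → G t c (toℕ k) m ≈ G t c (suc (toℕ k)) m
  G-uncolored t c k m r≤c = G-cong t c (toℕ k) (suc (toℕ k)) m same
    where
    same : ∀ i → J i c (toℕ k) ≡ J i c (suc (toℕ k)) ⊎ lookup m i ≡ 0
    same i with i Fin.≟ k
    ... | yes ≡.refl = inj₁ (≡.trans (J-before k c) (≡.trans (ℕ.m≤n⇒m⊓n≡m r≤c)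
                         (≡.sym (≡.trans (J-after k c) (ℕ.m≤n⇒m⊓n≡m (ℕ.m≤n⇒m≤1+n r≤c))))))
    ... | no  i≢k    = inj₁ (J-other c i≢k)

  colors≤ : ∀ t {c} k → c < lookup r k → c ≤ lookup r k ℕ.* suc t
  colors≤ t k c<r = ℕ.≤-trans (ℕ.<⇒≤ c<r) (ℕ.m≤m*n (lookup r k) (suc t))

  -- Since c < r_k, the count `J` of k goes from c to c + 1, while the others stay; `g-suc` applies
  -- at k with j = c.
  G-letter-inRange : ∀ t c k m {M} → c < lookup r k → c ≤ lookup r k ℕ.* t → lookup m k ≡ suc M →
               G t c (toℕ k) m ≈ G t c (suc (toℕ k)) m + z k ^ c * G t c (toℕ k) (updateAt m k pred)
  G-letter-inRange t c k m {M} c<r c≤rt mk≡1+M = begin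
    G t c (toℕ k) m
      ≈⟨ *-congˡ (∏-differ k same-g same-h atk) ⟩
    δ t c * (_ + z k ^ c * _)
      ≈⟨ solve 4 (λ a b c d → a :* (b :+ c :* d) := a :* b :+ c :* (a :* d)) refl (δ t c) _ (z k ^ c) _ ⟩
    G t c (suc (toℕ k)) m + z k ^ c * G t c (toℕ k) (updateAt m k pred)
      ∎
    where
    same-g : ∀ i → i ≢ k → g t i (J i c (toℕ k)) (lookup m i) ≈ g t i (J i c (suc (toℕ k))) (lookup m i)
    same-g i i≢k = reflexive (≡.cong (λ j → g t i j (lookup m i)) (J-other c i≢k))
    same-h : ∀ i → i ≢ k → g t i (J i c (toℕ k)) (lookup m i) ≈ g t i (J i c (toℕ k)) (lookup (updateAt m k pred) i)
    same-h i i≢k = reflexive (≡.cong (g t i (J i c (toℕ k))) (≡.sym (Vec.lookup∘updateAt′ i k i≢k m)))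
    atk : g t k (J k c (toℕ k)) (lookup m k) ≈
          g t k (J k c (suc (toℕ k))) (lookup m k) + z k ^ c * g t k (J k c (toℕ k)) (lookup (updateAt m k pred) k)
    atk rewrite Vec.lookup∘updateAt k {pred} m | mk≡1+M | J-before k c | J-after k c
              | ℕ.m≥n⇒m⊓n≡n c<r | ℕ.m≥n⇒m⊓n≡n (ℕ.<⇒≤ c<r) = g-suc t k c M c≤rt

  -- For t = 0 and c > 0 the exponent c exceeds r_k t, but then all three terms vanish through `δ`.
  G-letter : ∀ t c k m {M} → c < lookup r k → lookup m k ≡ suc M →
             G t c (toℕ k) m ≈ G t c (suc (toℕ k)) m + z k ^ c * G t c (toℕ k) (updateAt m k pred)
  G-letter zero    (suc c) k m c<r mk≡1+M =
    trans (zeroˡ _) (sym (trans (+-cong (zeroˡ _) (trans (*-congˡ (zeroˡ _)) (zeroʳ _))) (+-identityˡ 0#)))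
  G-letter zero    zero    k m c<r = G-letter-inRange zero zero k m c<r z≤n
  G-letter (suc t) c       k m c<r = G-letter-inRange (suc t) c k m c<r (colors≤ t k c<r)

  -- Below either bound every letter has min(r_i, c + 1) colors. The hypothesis can fail only for t
  -- = c = 0, where passing the appended letter changes `δ`.
  G-wrap : ∀ t c m → δ t c ≡ δ t (suc c) → G t c n m ≈ G t (suc c) 0 m
  G-wrap t c m δ≡ = *-cong (reflexive δ≡)
    (∏.⨁-cong (allFin n) (λ i → reflexive (≡.cong (λ j → g t i j (lookup m i)) (J-last i c))))

  -- Every letter has a first color, so `J` is 1 and the exponents come from the empty set {1, ...,
  -- 0}.
  g₀-last : ∀ m i → g 0 i (J i 0 n) (lookup m i) ≈ h (z i) 0 (lookup m i) * z i ^ lookup m i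
  g₀-last m i rewrite J-last i 0 | ℕ.m≥n⇒m⊓n≡n (1≤r i) | ℕ.*-zeroʳ (lookup r i) | ℕ.+-identityʳ (lookup m i) = *-comm _ _

  G₀-empty : ∀ m → Vec.sum m ≡ 0 → G 0 0 n m ≈ 1#
  G₀-empty m m≡0 = trans (*-identityˡ _) (∏.⨁-ε (allFin n) one)
    where
    one : ∀ i → g 0 i (J i 0 n) (lookup m i) ≈ 1#
    one i rewrite sum≡0⇒lookup≡0 m m≡0 i = g-zero 0 i (J i 0 n)

  G₀-nonempty : ∀ m {s} → Vec.sum m ≡ suc s → G 0 0 n m ≈ 0#
  G₀-nonempty m m≡s with k , M , mk≡1+M ← sum≡suc⇒lookup≡suc m m≡s =
    trans (*-congˡ (∏-zero k (trans (g₀-last m k) (trans (*-congʳ vanish) (zeroˡ _))))) (zeroʳ _)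
    where
    vanish : h (z k) 0 (lookup m k) ≈ 0#
    vanish rewrite mk≡1+M = refl

  τ : Vec ℕ n → Carrier
  τ m = ∏ (allFin n) (λ i → z i ^ (lookup r i ℕ.* lookup m i))

  δ-zero : ∀ t → δ t 0 ≈ 1#
  δ-zero zero    = refl
  δ-zero (suc t) = refl

  -- Beyond all colors `J` is r_i, and {r_i, ..., r_i (t + 1)} is {0, ..., r_i t} raised by r_i;
  -- over all letters this gives `τ`.
  G-end : ∀ t c m → (∀ i → lookup r i ≤ c) → G (suc t) c 0 m ≈ τ m * G t 0 0 m
  G-end t c m r≤c = begin
    1# * ∏ (allFin n) (λ i → g (suc t) i (lookup r i ⊓ c) (lookup m i))
      ≈⟨ *-identityˡ _ ⟩
    ∏ (allFin n) (λ i → g (suc t) i (lookup r i ⊓ c) (lookup m i))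
      ≈⟨ ∏.⨁-cong (allFin n) shift ⟩
    ∏ (allFin n) (λ i → z i ^ (lookup r i ℕ.* lookup m i) * g t i (lookup r i ⊓ 0) (lookup m i))
      ≈⟨ ∏.⨁-∙ (allFin n) _ _ ⟩
    τ m * ∏ (allFin n) (λ i → g t i (lookup r i ⊓ 0) (lookup m i))
      ≈⟨ *-congˡ (trans (*-congʳ (δ-zero t)) (*-identityˡ _)) ⟨
    τ m * G t 0 0 m
      ∎
    where
    l≡ : ∀ i → suc (lookup r i ℕ.* suc t) ∸ lookup r i ≡ suc (lookup r i ℕ.* t)
    l≡ i rewrite ℕ.*-suc (lookup r i) t | ≡.sym (ℕ.+-suc (lookup r i) (lookup r i ℕ.* t)) =
      ℕ.m+n∸m≡n (lookup r i) _
    shift : ∀ i → g (suc t) i (lookup r i ⊓ c) (lookup m i) ≈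
                  z i ^ (lookup r i ℕ.* lookup m i) * g t i (lookup r i ⊓ 0) (lookup m i)
    shift i rewrite ℕ.m≤n⇒m⊓n≡m (r≤c i) | ℕ.⊓-zeroʳ (lookup r i) | l≡ i = *-congˡ (sym (*-identityˡ _))

  G-first : ∀ t m → G t 0 0 m ≈ ∏ (allFin n) (λ i → h (z i) (suc (lookup r i ℕ.* t)) (lookup m i))
  G-first t m = trans (*-congʳ (δ-zero t)) (trans (*-identityˡ _) (∏.⨁-cong (allFin n) first))
    where
    first : ∀ i → g t i (J i 0 0) (lookup m i) ≈ h (z i) (suc (lookup r i ℕ.* t)) (lookup m i)
    first i rewrite ℕ.⊓-zeroʳ (lookup r i) = *-identityˡ _

  -- The sum over t is truncated, as an arbitrary ring has no infinite sums.
  P : ℕ → ℕ → ℕ → Vec ℕ n → Carrier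
  P T c k m = ∑ (upTo T) (λ t → w ^ t * G t c k m)

  P-cong : ∀ T c k c′ k′ m → (∀ t → G t c k m ≈ G t c′ k′ m) → P T c k m ≈ P T c′ k′ m
  P-cong T c k c′ k′ m eq = ∑.⨁-cong (upTo T) (λ t → *-congˡ (eq t))

  P-letter : ∀ T c k m {M} → c < lookup r k → lookup m k ≡ suc M →
             P T c (toℕ k) m ≈ P T c (suc (toℕ k)) m + z k ^ c * P T c (toℕ k) (updateAt m k pred)
  P-letter T c k m c<r mk≡1+M = begin
    P T c (toℕ k) m
      ≈⟨ ∑.⨁-cong (upTo T) (λ t → trans (*-congˡ (G-letter t c k m c<r mk≡1+M))
           (solve 4 (λ a b c d → a :* (b :+ c :* d) := a :* b :+ c :* (a :* d)) refl (w ^ t) _ (z k ^ c) _)) ⟩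
    ∑ (upTo T) (λ t → w ^ t * G t c (suc (toℕ k)) m + z k ^ c * (w ^ t * G t c (toℕ k) (updateAt m k pred)))
      ≈⟨ ∑.⨁-∙ (upTo T) _ _ ⟩
    P T c (suc (toℕ k)) m + ∑ (upTo T) (λ t → z k ^ c * (w ^ t * G t c (toℕ k) (updateAt m k pred)))
      ≈⟨ +-congˡ (∑-*ˡ (upTo T) (z k ^ c) _) ⟨
    P T c (suc (toℕ k)) m + z k ^ c * P T c (toℕ k) (updateAt m k pred)
      ∎

  P-wrap : ∀ T c m → P T (suc c) n m ≈ P T (suc (suc c)) 0 m
  P-wrap T c m = P-cong T (suc c) n (suc (suc c)) 0 m λ where
    zero    → G-wrap zero (suc c) m ≡.refl
    (suc t) → G-wrap (suc t) (suc c) m ≡.refl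

  -- Only the term t = 0 changes: it is `e` before and 0 after, by `δ`. The truncation at `suc T`
  -- guarantees that this term is present.
  P-wrap₀ : ∀ T m {e} → G 0 0 n m ≈ e → P (suc T) 0 n m ≈ P (suc T) 1 0 m + e
  P-wrap₀ T m {e} G≈e = begin
    P (suc T) 0 n m
      ≡⟨ ∑.⨁-upTo T _ ⟩
    1# * G 0 0 n m + ∑ (upTo T) (λ t → w ^ suc t * G (suc t) 0 n m)
      ≈⟨ +-cong (trans (*-identityˡ _) G≈e) (∑.⨁-cong (upTo T) (λ t → *-congˡ (G-wrap (suc t) 0 m ≡.refl))) ⟩
    e + ∑ (upTo T) (λ t → w ^ suc t * G (suc t) 1 0 m)
      ≈⟨ +-comm _ _ ⟩
    ∑ (upTo T) (λ t → w ^ suc t * G (suc t) 1 0 m) + e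
      ≈⟨ +-congʳ (trans (+-congʳ (trans (*-identityˡ _) (zeroˡ _))) (+-identityˡ _)) ⟨
    1# * G 0 1 0 m + ∑ (upTo T) (λ t → w ^ suc t * G (suc t) 1 0 m) + e
      ≡⟨ ≡.cong (_+ e) (∑.⨁-upTo T _) ⟨
    P (suc T) 1 0 m + e
      ∎

  -- The term t = 0 vanishes through `δ`, as the color index is positive; the others shift to t - 1,
  -- which gives the factor w and shortens the truncation by one.
  P-end : ∀ T c m → (∀ i → lookup r i ≤ suc c) → P (suc T) (suc c) 0 m ≈ τ m * w * P T 0 0 m
  P-end T c m r≤c = begin
    P (suc T) (suc c) 0 m
      ≡⟨ ∑.⨁-upTo T _ ⟩
    1# * G 0 (suc c) 0 m + ∑ (upTo T) (λ t → w ^ suc t * G (suc t) (suc c) 0 m)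
      ≈⟨ +-cong (trans (*-identityˡ _) (zeroˡ _)) (∑.⨁-cong (upTo T) (λ t → trans (*-congˡ (G-end t (suc c) m r≤c))
           (solve 4 (λ a b c d → a :* b :* (c :* d) := c :* a :* (b :* d)) refl w (w ^ t) (τ m) _))) ⟩
    0# + ∑ (upTo T) (λ t → τ m * w * (w ^ t * G t 0 0 m))
      ≈⟨ +-identityˡ _ ⟩
    ∑ (upTo T) (λ t → τ m * w * (w ^ t * G t 0 0 m))
      ≈⟨ ∑-*ˡ (upTo T) (τ m * w) _ ⟨
    τ m * w * P T 0 0 m
      ∎

-- The recurrences for words

<ᶜ-irrefl : ∀ x → ¬ x <ᶜ x
<ᶜ-irrefl x (inj₁ c<c)       = ℕ.<-irrefl ≡.refl c<c
<ᶜ-irrefl x (inj₂ (_ , k<k)) = ℕ.<-irrefl ≡.refl k<k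

<ᶜ-step : ∀ x c k → x ≢ (c , k) → does (x <ᶜ? (c , k)) ≡ does (x <ᶜ? (c , suc k))
<ᶜ-step x c k x≢ = does-⇔ (mk⇔ to from) (x <ᶜ? (c , k)) (x <ᶜ? (c , suc k))
  where
  to : x <ᶜ (c , k) → x <ᶜ (c , suc k)
  to (inj₁ <c)       = inj₁ <c
  to (inj₂ (≡c , <k)) = inj₂ (≡c , ℕ.m<n⇒m<1+n <k)
  from : x <ᶜ (c , suc k) → x <ᶜ (c , k)
  from (inj₁ <c)            = inj₁ <c
  from (inj₂ (≡.refl , <1+k)) = inj₂ (≡.refl , ℕ.≤∧≢⇒< (ℕ.≤-pred <1+k) (λ { ≡.refl → x≢ ≡.refl }))

-- From the lower bound up to the upper one there are only (c , k), the pairs of color c beyond k,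
-- excluded by `proj₂ x ≤ k`, and those of color c + 1 below 1, excluded by `1 ≤ proj₂ x`.
<ᶜ-wrap : ∀ x c k → 1 ≤ proj₂ x → proj₂ x ≤ k → x ≢ (c , k) → does (x <ᶜ? (c , k)) ≡ does (x <ᶜ? (suc c , 1))
<ᶜ-wrap x c k 1≤x x≤k x≢ = does-⇔ (mk⇔ to from) (x <ᶜ? (c , k)) (x <ᶜ? (suc c , 1))
  where
  to : x <ᶜ (c , k) → x <ᶜ (suc c , 1)
  to (inj₁ <c)            = inj₁ (ℕ.m<n⇒m<1+n <c)
  to (inj₂ (≡.refl , _)) = inj₁ ℕ.≤-refl
  from : x <ᶜ (suc c , 1) → x <ᶜ (c , k)
  from (inj₂ (_ , x<1)) = ⊥-elim (ℕ.<⇒≱ x<1 1≤x)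
  from (inj₁ x<1+c) with ℕ.m≤n⇒m<n∨m≡n (ℕ.≤-pred x<1+c)
  ... | inj₁ x<c     = inj₁ x<c
  ... | inj₂ ≡.refl = inj₂ (≡.refl , ℕ.≤∧≢⇒< x≤k (λ { ≡.refl → x≢ ≡.refl }))

lookup≤sum : ∀ {n} (r : Vec ℕ n) k → lookup r k ≤ Vec.sum r
lookup≤sum (a ∷ r) zero    = ℕ.m≤m+n a _
lookup≤sum (a ∷ r) (suc k) = ℕ.≤-trans (lookup≤sum r k) (ℕ.m≤n+m _ a)

module ColoredWords {n} (r : Vec ℕ n) where

  first : ∀ {l} → Word r l → ColoredInteger
  first v = lookup (extend r v) zero

  1≤first : ∀ {l} (v : Word r l) → 1 ≤ proj₂ (first v)
  1≤first []      = s≤s z≤n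
  1≤first (_ ∷ _) = s≤s z≤n

  first≤1+n : ∀ {l} (v : Word r l) → proj₂ (first v) ≤ suc n
  first≤1+n []            = ℕ.≤-refl
  first≤1+n ((k , _) ∷ _) = s≤s (ℕ.<⇒≤ (Fin.toℕ<n k))

  first-≮-1,1 : ∀ {l} (v : Word r l) → ¬ first v <ᶜ (1 , 1)
  first-≮-1,1 []      (inj₁ (s≤s ()))
  first-≮-1,1 []      (inj₂ (_ , s≤s ()))
  first-≮-1,1 (_ ∷ _) (inj₁ (s≤s ()))
  first-≮-1,1 (_ ∷ _) (inj₂ (_ , s≤s ()))

  first-<-end : ∀ {c} → (∀ i → lookup r i ≤ suc c) → ∀ {l} (v : Word r l) → first v <ᶜ (suc (suc c) , 1)
  first-<-end r≤c []            = inj₁ (s≤s (s≤s z≤n))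
  first-<-end r≤c ((k , d) ∷ _) = inj₁ (s≤s (ℕ.≤-trans (Fin.toℕ<n d) (r≤c k)))

  first-uncolored : ∀ {c} (k : Fin n) → lookup r k ≤ c → ∀ {l} (v : Word r l) → first v ≢ (suc c , suc (toℕ k))
  first-uncolored k r≤c []             eq = ℕ.<-irrefl (≡.sym (ℕ.suc-injective (,-injectiveʳ eq))) (Fin.toℕ<n k)
  first-uncolored k r≤c ((k′ , d) ∷ _) eq with Fin.toℕ-injective (ℕ.suc-injective (,-injectiveʳ eq)) | ℕ.suc-injective (,-injectiveˡ eq)
  ... | ≡.refl | ≡.refl = ℕ.<⇒≱ (Fin.toℕ<n d) r≤c

  first-∷≢end : ∀ {c} {l} (v : Word r (suc l)) → first v ≢ (c , suc n)
  first-∷≢end ((k , _) ∷ _) eq = ℕ.<-irrefl (ℕ.suc-injective (,-injectiveʳ eq)) (Fin.toℕ<n k)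

  first≢end : ∀ {c} {l} (v : Word r l) → first v ≢ (suc (suc c) , suc n)
  first≢end []      ()
  first≢end (x ∷ v) = first-∷≢end (x ∷ v)

  multiplicity : ∀ {l} → Word r l → Fin n → ℕ
  multiplicity v k = count (λ x → proj₁ x Fin.≟ k) v

  Content : Vec ℕ n → ∀ {l} → Word r l → Set
  Content m v = ∀ k → multiplicity v k ≡ lookup m k

  content? : ∀ m {l} → Unary.Decidable (Content m {l})
  content? m v = Fin.all? (λ k → _ ℕ.≟ _)

  multiplicity-same : ∀ {k c l} (v : Word r l) → multiplicity ((k , c) ∷ v) k ≡ suc (multiplicity v k)
  multiplicity-same {k} v rewrite dec-true (k Fin.≟ k) ≡.refl = ≡.refl

  multiplicity-other : ∀ {k c i l} (v : Word r l) → i ≢ k → multiplicity ((k , c) ∷ v) i ≡ multiplicity v i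
  multiplicity-other {k} {c} {i} v i≢k rewrite dec-false (k Fin.≟ i) (i≢k ∘ ≡.sym) = ≡.refl

  first-absent : ∀ {m c} (k : Fin n) → lookup m k ≡ 0 → ∀ {l} (v : Word r l) → Content m v → first v ≢ (suc c , suc (toℕ k))
  first-absent k mk≡0 []             _       eq = ℕ.<-irrefl (≡.sym (ℕ.suc-injective (,-injectiveʳ eq))) (Fin.toℕ<n k)
  first-absent k mk≡0 ((k′ , d) ∷ v) content eq with Fin.toℕ-injective (ℕ.suc-injective (,-injectiveʳ eq))
  ... | ≡.refl with () ← ≡.trans (≡.sym (multiplicity-same {k} {d} v)) (≡.trans (content k) mk≡0)

  -- Stated for `does` because the sums branch on it. The hypothesis lets `pred` be undone at `k` in
  -- the converse direction.
  content-∷ : ∀ {m k M c l} (v : Word r l) → lookup m k ≡ suc M →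
              does (content? m ((k , c) ∷ v)) ≡ does (content? (updateAt m k pred) v)
  content-∷ {m} {k} {M} {c} v mk≡1+M = does-⇔ (mk⇔ to from) (content? m ((k , c) ∷ v)) (content? (updateAt m k pred) v)
    where
    to : Content m ((k , c) ∷ v) → Content (updateAt m k pred) v
    to content i with i Fin.≟ k
    ... | yes ≡.refl = ≡.trans (≡.cong pred (≡.trans (≡.sym (multiplicity-same {k} {c} v)) (content k))) (≡.sym (Vec.lookup∘updateAt k m))
    ... | no  i≢k    = ≡.trans (≡.sym (multiplicity-other {k} {c} v i≢k)) (≡.trans (content i) (≡.sym (Vec.lookup∘updateAt′ i k i≢k m)))
    from : Content (updateAt m k pred) v → Content m ((k , c) ∷ v)
    from content i with i Fin.≟ k
    ... | no  i≢k    = ≡.trans (multiplicity-other {k} {c} v i≢k) (≡.trans (content i) (Vec.lookup∘updateAt′ i k i≢k m))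
    ... | yes ≡.refl = ≡.trans (multiplicity-same {k} {c} v) (≡.trans (≡.cong suc (≡.trans (content k)
                         (≡.trans (Vec.lookup∘updateAt k m) (≡.cong pred mk≡1+M)))) (≡.sym mk≡1+M))

module WordSide {a ℓ} (R : CommutativeRing a ℓ) {n} (r : Vec ℕ n) (1≤r : ∀ k → 1 ≤ lookup r k)
  (z : Fin n → CommutativeRing.Carrier R) (w : CommutativeRing.Carrier R) where
  open CommutativeRing R hiding (zero)
  open import Relation.Binary.Reasoning.Setoid setoid
  open Exp semiring using (_^_; ^-congʳ; ^-homo-*)
  open RingSums R
  open ColoredWords r
  open MultisetSide R r 1≤r z w
  open Multisets R
  open NaturalCoefficients commutativeSemiring using (solve; _:+_; _:*_; _:=_)

  tail : ∀ {l} → Word r l → Carrier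
  tail v = ∏ (toList v) (λ x → z (proj₁ x) ^ lookup r (proj₁ x)) * w

  -- If the first letter lies below `a`, the bound (0 , a) forces s₁ ≥ 1; raising all values and t
  -- by one multiplies by `tail v`.
  weight : ColoredInteger → ∀ {l} → Word r l → Carrier
  weight a v = if does (first v <ᶜ? a) then tail v else 1#

  ∏-multiplicity : ∀ {l} (v : Word r l) → ∏ (toList v) (λ x → z (proj₁ x) ^ lookup r (proj₁ x)) ≈
                   ∏ (allFin n) (λ i → z i ^ (lookup r i ℕ.* multiplicity v i))
  ∏-multiplicity []            = sym (∏.⨁-ε (allFin n) (λ i → ^-congʳ (z i) (ℕ.*-zeroʳ (lookup r i))))
  ∏-multiplicity ((k , c) ∷ v) = sym (trans (∏-scale k other same) (*-congˡ (sym (∏-multiplicity v))))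
    where
    other : ∀ i → i ≢ k → z i ^ (lookup r i ℕ.* multiplicity ((k , c) ∷ v) i) ≈ z i ^ (lookup r i ℕ.* multiplicity v i)
    other i i≢k = ^-congʳ (z i) (≡.cong (lookup r i ℕ.*_) (multiplicity-other {k = k} {c} v i≢k))
    same : z k ^ (lookup r k ℕ.* multiplicity ((k , c) ∷ v) k) ≈ z k ^ lookup r k * z k ^ (lookup r k ℕ.* multiplicity v k)
    same = trans (^-congʳ (z k) (≡.trans (≡.cong (lookup r k ℕ.*_) (multiplicity-same {k = k} {c} v)) (ℕ.*-suc (lookup r k) (multiplicity v k))))
      (^-homo-* (z k) (lookup r k) _)

  -- The factor for raising all values depends only on the content, hence comes out of the sum in
  -- `Q-end`.
  tail-content : ∀ m {l} (v : Word r l) → Content m v → tail v ≈ τ m * w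
  tail-content m v content = *-congʳ (trans (∏-multiplicity v)
    (∏.⨁-cong (allFin n) (λ i → ^-congʳ (z i) (≡.cong (lookup r i ℕ.*_) (content i)))))

  if-dec : ∀ {p} {P : Set p} (P? : Dec P) {x y} → (P → x ≈ y) → (if does P? then x else 0#) ≈ (if does P? then y else 0#)
  if-dec (yes p) x≈y = x≈y p
  if-dec (no  _) x≈y = refl

  -- An indicator instead of `filter` keeps `words r l` as the index list for every content, so that
  -- sums for different contents are combined word by word.
  ∑-content : ∀ l → Vec ℕ n → (Word r l → Carrier) → Carrier
  ∑-content l m F = ∑ (words r l) (λ v → if does (content? m v) then F v else 0#)

  ∑-content-cong : ∀ l m {F F′} → (∀ v → Content m v → F v ≈ F′ v) → ∑-content l m F ≈ ∑-content l m F′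
  ∑-content-cong l m F≈F′ = ∑.⨁-cong (words r l) (λ v → if-dec (content? m v) (F≈F′ v))

  if-*ˡ : ∀ x b {y} → x * (if b then y else 0#) ≈ (if b then x * y else 0#)
  if-*ˡ x true  = refl
  if-*ˡ x false = zeroʳ x

  if-+ : ∀ b {x y} → (if b then x + y else 0#) ≈ (if b then x else 0#) + (if b then y else 0#)
  if-+ true  = refl
  if-+ false = sym (+-identityˡ 0#)

  ∑-content-*ˡ : ∀ l m x F → x * ∑-content l m F ≈ ∑-content l m (λ v → x * F v)
  ∑-content-*ˡ l m x F = trans (∑-*ˡ (words r l) x _) (∑.⨁-cong (words r l) (λ v → if-*ˡ x (does (content? m v))))

  -- Congruence modulo powers of w

  infix 4 _~[_]_
  -- The quotient is kept explicitly: `R` is arbitrary here, and only for power series is w^T times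
  -- the quotient seen to vanish below order T.
  record _~[_]_ (f : Carrier) (T : ℕ) (g : Carrier) : Set (a ⊔ ℓ) where
    constructor _,_
    field
      quotient : Carrier
      equality : f ≈ g + w ^ T * quotient

  ~-zero : ∀ f g → f ~[ 0 ] g
  ~-zero f g = f - g , (begin
    f                  ≈⟨ +-identityʳ f ⟨
    f + 0#             ≈⟨ +-congˡ (-‿inverseˡ g) ⟨
    f + (- g + g)      ≈⟨ +-assoc f (- g) g ⟨
    f - g + g          ≈⟨ +-comm _ _ ⟩
    g + (f - g)        ≈⟨ +-congˡ (*-identityˡ _) ⟨
    g + 1# * (f - g)   ∎)

  ~-refl : ∀ {T} f → f ~[ T ] f
  ~-refl {T} f = 0# , sym (trans (+-congˡ (zeroʳ (w ^ T))) (+-identityʳ f))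

  ~-respects : ∀ {T f f′ g g′} → f ≈ f′ → g ≈ g′ → f′ ~[ T ] g′ → f ~[ T ] g
  ~-respects f≈f′ g≈g′ (x , eq) = x , trans f≈f′ (trans eq (+-congʳ (sym g≈g′)))

  ~-+ : ∀ {T f f′ g g′} → f ~[ T ] g → f′ ~[ T ] g′ → f + f′ ~[ T ] g + g′
  ~-+ {T} {g = g} {g′} (x , eq) (x′ , eq′) = x + x′ , trans (+-cong eq eq′)
    (solve 5 (λ g g′ p x x′ → g :+ p :* x :+ (g′ :+ p :* x′) := g :+ g′ :+ p :* (x :+ x′)) refl g g′ (w ^ T) x x′)

  ~-*ˡ : ∀ {T} y {f g} → f ~[ T ] g → y * f ~[ T ] y * g
  ~-*ˡ {T} y {g = g} (x , eq) = y * x , trans (*-congˡ eq)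
    (solve 4 (λ y g p x → y :* (g :+ p :* x) := y :* g :+ p :* (y :* x)) refl y g (w ^ T) x)

  -- The modulus gains a power here, from the factor w that `P-end` and `Q-end` have in common.
  ~-w*ˡ : ∀ {T} y {f g} → f ~[ T ] g → y * w * f ~[ suc T ] y * w * g
  ~-w*ˡ {T} y {g = g} (x , eq) = y * x , trans (*-congˡ eq)
    (solve 5 (λ y w g p x → y :* w :* (g :+ p :* x) := y :* w :* g :+ w :* p :* (y :* x)) refl y w g (w ^ T) x)

  -- The summands enter through these two recurrences alone, in which the denominator's factor for
  -- the first position is cleared. In terms of sequences, s₁ = 0 leaves a sequence for v bounded
  -- below by (0 , x), and s₁ ≥ 1 allows all values to be lowered by one.
  module _ (s : ∀ {l} → Word r l → Carrier) (s-[] : s [] ≈ 1# + w * s [])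
    (s-∷ : ∀ {l} x (v : Word r l) → s (x ∷ v) ≈
           z (proj₁ x) ^ toℕ (proj₂ x) * (weight (toColoredInteger r x) v * s v) + tail (x ∷ v) * s (x ∷ v)) where

    -- The counterpart of `P` for words, where `s` accounts for all t at once.
    Q : ∀ l → ColoredInteger → Vec ℕ n → Carrier
    Q l a m = ∑-content l m (λ v → weight a v * s v)

    Q-cong : ∀ l a b m → (∀ v → Content m v → does (first v <ᶜ? a) ≡ does (first v <ᶜ? b)) → Q l a m ≈ Q l b m
    Q-cong l a b m eq = ∑-content-cong l m (λ v content →
      *-congʳ (reflexive (≡.cong (λ x → if x then tail v else 1#) (eq v content))))

    Q-first : ∀ l m → Q l (1 , 1) m ≈ ∑-content l m s
    Q-first l m = ∑-content-cong l m (λ v _ → trans (*-congʳ (reflexive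
      (≡.cong (λ x → if x then tail v else 1#) (dec-false (first v <ᶜ? (1 , 1)) (first-≮-1,1 v))))) (*-identityˡ _))

    Q-end : ∀ l c m → (∀ i → lookup r i ≤ suc c) → Q l (suc (suc c) , 1) m ≈ τ m * w * Q l (1 , 1) m
    Q-end l c m r≤c = trans (∑-content-cong l m (λ v content → *-congʳ (trans (reflexive
        (≡.cong (λ x → if x then tail v else 1#) (dec-true (first v <ᶜ? (suc (suc c) , 1)) (first-<-end r≤c v))))
        (tail-content m v content))))
      (trans (sym (∑-content-*ˡ l m (τ m * w) s)) (*-congˡ (sym (Q-first l m))))

    -- The appended letter is not below itself, so the weight of the empty word passes from 1 to w;
    -- by `s-[]` this loses exactly 1.
    Q-wrap₀ : ∀ m → Vec.sum m ≡ 0 → Q 0 (1 , suc n) m ≈ Q 0 (2 , 1) m + 1#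
    Q-wrap₀ m m≡0
      rewrite dec-true (content? m []) (λ k → ≡.sym (sum≡0⇒lookup≡0 m m≡0 k))
            | dec-false ((1 , suc n) <ᶜ? (1 , suc n)) (<ᶜ-irrefl (1 , suc n))
            | dec-true ((1 , suc n) <ᶜ? (2 , 1)) (inj₁ (s≤s (s≤s z≤n))) = begin
      1# * s [] + 0#            ≈⟨ trans (+-identityʳ _) (*-identityˡ _) ⟩
      s []                      ≈⟨ s-[] ⟩
      1# + w * s []             ≈⟨ +-comm _ _ ⟩
      w * s [] + 1#             ≈⟨ +-congʳ (trans (+-identityʳ _) (*-congʳ (*-identityˡ w))) ⟨
      1# * w * s [] + 0# + 1#   ∎

    E : ∀ l → ColoredInteger → Vec ℕ n → ColoredLetter r → Carrier
    E l a m x = ∑ (words r l) (λ v → if does (content? m (x ∷ v)) then weight a (x ∷ v) * s (x ∷ v) else 0#)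

    Q-suc : ∀ l a m → Q (suc l) a m ≈ ∑ (allFin n) (λ k → ∑ (allFin (lookup r k)) (λ c → E l a m (k , c)))
    Q-suc l a m = begin
      Q (suc l) a m
        ≈⟨ ∑.⨁-concatMap (λ x → map (x ∷_) (words r l)) (coloredLetters r) _ ⟩
      ∑ (coloredLetters r) (λ x → ∑ (map (x ∷_) (words r l)) (λ v → if does (content? m v) then weight a v * s v else 0#))
        ≈⟨ ∑.⨁-cong (coloredLetters r) (λ x → reflexive (∑.⨁-map (x ∷_) (words r l) _)) ⟩
      ∑ (coloredLetters r) (E l a m)
        ≈⟨ ∑.⨁-concatMap (λ k → map (k ,_) (allFin (lookup r k))) (allFin n) _ ⟩
      ∑ (allFin n) (λ k → ∑ (map (k ,_) (allFin (lookup r k))) (E l a m))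
        ≈⟨ ∑.⨁-cong (allFin n) (λ k → reflexive (∑.⨁-map (k ,_) (allFin (lookup r k)) (E l a m))) ⟩
      ∑ (allFin n) (λ k → ∑ (allFin (lookup r k)) (λ c → E l a m (k , c)))
        ∎

    E-cong : ∀ l a b m x → does (toColoredInteger r x <ᶜ? a) ≡ does (toColoredInteger r x <ᶜ? b) → E l a m x ≈ E l b m x
    E-cong l a b m x eq = ∑.⨁-cong (words r l) (λ v → reflexive
      (≡.cong (λ y → if does (content? m (x ∷ v)) then (if y then tail (x ∷ v) else 1#) * s (x ∷ v) else 0#) eq))

    E-letter : ∀ l m (k : Fin n) (c : Fin (lookup r k)) {M} → lookup m k ≡ suc M →
               E l (suc (toℕ c) , suc (toℕ k)) m (k , c) ≈
               E l (suc (toℕ c) , suc (suc (toℕ k))) m (k , c) +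
               z k ^ toℕ c * Q l (suc (toℕ c) , suc (toℕ k)) (updateAt m k pred)
    E-letter l m k c {M} mk≡1+M = begin
      E l x m (k , c)
        ≈⟨ ∑.⨁-cong (words r l) eq ⟩
      ∑ (words r l) (λ v → e⁺ v + (z k ^ toℕ c * e′ v))
        ≈⟨ ∑.⨁-∙ (words r l) _ _ ⟩
      E l x⁺ m (k , c) + ∑ (words r l) (λ v → z k ^ toℕ c * e′ v)
        ≈⟨ +-congˡ (∑-*ˡ (words r l) (z k ^ toℕ c) e′) ⟨
      E l x⁺ m (k , c) + z k ^ toℕ c * Q l x (updateAt m k pred)
        ∎
      where
      x x⁺ : ColoredInteger
      x  = suc (toℕ c) , suc (toℕ k)
      x⁺ = suc (toℕ c) , suc (suc (toℕ k))
      e⁺ e′ : Word r l → Carrier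
      e⁺ v = if does (content? m ((k , c) ∷ v)) then weight x⁺ ((k , c) ∷ v) * s ((k , c) ∷ v) else 0#
      e′ v = if does (content? (updateAt m k pred) v) then weight x v * s v else 0#
      inner : ∀ v → weight x ((k , c) ∷ v) * s ((k , c) ∷ v) ≈
                    weight x⁺ ((k , c) ∷ v) * s ((k , c) ∷ v) + z k ^ toℕ c * (weight x v * s v)
      -- The first letter is not below x but is below x⁺, so the weights are 1 and the tail, and
      -- `s-∷` is the whole identity.
      inner v rewrite dec-false (x <ᶜ? x) (<ᶜ-irrefl x) | dec-true (x <ᶜ? x⁺) (inj₂ (≡.refl , ℕ.≤-refl)) =
        trans (*-identityˡ _) (trans (s-∷ (k , c) v) (+-comm _ _))
      eq : ∀ v → (if does (content? m ((k , c) ∷ v)) then weight x ((k , c) ∷ v) * s ((k , c) ∷ v) else 0#) ≈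
                 e⁺ v + z k ^ toℕ c * e′ v
      eq v = trans (if-dec (content? m ((k , c) ∷ v)) (λ _ → inner v))
        (trans (if-+ (does (content? m ((k , c) ∷ v))))
          (+-congˡ (trans (sym (if-*ˡ _ (does (content? m ((k , c) ∷ v)))))
            (*-congˡ (reflexive (≡.cong (λ b → if b then weight x v * s v else 0#)
              (content-∷ {m = m} {k} {M} {c} v mk≡1+M)))))))

    -- Only words that start with k^c change their position relative to the bound; `∑-differ`
    -- isolates first k, then c.
    Q-letter : ∀ l m (k : Fin n) (c : Fin (lookup r k)) {M} → lookup m k ≡ suc M →
               Q (suc l) (suc (toℕ c) , suc (toℕ k)) m ≈
               Q (suc l) (suc (toℕ c) , suc (suc (toℕ k))) m +
               z k ^ toℕ c * Q l (suc (toℕ c) , suc (toℕ k)) (updateAt m k pred)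
    Q-letter l m k c mk≡1+M = begin
      Q (suc l) x m
        ≈⟨ Q-suc l x m ⟩
      ∑ (allFin n) (λ i → ∑ (allFin (lookup r i)) (λ d → E l x m (i , d)))
        ≈⟨ ∑-differ k
             (λ i i≢k → ∑.⨁-cong (allFin (lookup r i)) (λ d → E-cong l x x⁺ m (i , d)
               (<ᶜ-step (toColoredInteger r (i , d)) (suc (toℕ c)) (suc (toℕ k)) (i≢k ∘ Fin.toℕ-injective ∘ ℕ.suc-injective ∘ ,-injectiveʳ))))
             (∑-differ c
               (λ d d≢c → E-cong l x x⁺ m (k , d) (<ᶜ-step (toColoredInteger r (k , d)) (suc (toℕ c)) (suc (toℕ k)) (d≢c ∘ Fin.toℕ-injective ∘ ℕ.suc-injective ∘ ,-injectiveˡ)))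
               (E-letter l m k c mk≡1+M)) ⟩
      ∑ (allFin n) (λ i → ∑ (allFin (lookup r i)) (λ d → E l x⁺ m (i , d))) + z k ^ toℕ c * Q l x (updateAt m k pred)
        ≈⟨ +-congʳ (Q-suc l x⁺ m) ⟨
      Q (suc l) x⁺ m + z k ^ toℕ c * Q l x (updateAt m k pred)
        ∎
      where
      x x⁺ : ColoredInteger
      x  = suc (toℕ c) , suc (toℕ k)
      x⁺ = suc (toℕ c) , suc (suc (toℕ k))

    -- The descent of the bound

    C : ℕ
    C = Vec.sum r

    -- `T` is both the truncation of `P` and the modulus, so that T = 0 is the trivial base case.
    -- Indices start at 0, colored integers at 1; k = n is the appended letter.
    Claim : ℕ → ℕ → Vec ℕ n → ℕ → ℕ → Set (a ⊔ ℓ)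
    Claim l T m c k = P T c k m ~[ T ] Q l (suc c , suc k) m

    claim-end : ∀ l T m → Claim l T m 0 0 → Claim l (suc T) m (suc C) 0
    claim-end l T m = ~-respects (P-end T C m r≤) (Q-end l C m r≤) ∘ ~-w*ˡ (τ m)
      where
      r≤ : ∀ i → lookup r i ≤ suc C
      r≤ i = ℕ.m≤n⇒m≤1+n (lookup≤sum r i)

    -- Both sides lose 1 for the empty word at (n+1)^1. Otherwise neither loses anything: no word
    -- starts with the bound that is passed, and the term t = 0 is zero on both sides of it.
    claim-wrap : ∀ l T m c → Vec.sum m ≡ l → Claim l (suc T) m (suc c) 0 → Claim l (suc T) m c n
    claim-wrap l T m (suc c) _ = ~-respects (P-wrap (suc T) c m)
      (Q-cong l (suc (suc c) , suc n) (suc (suc (suc c)) , 1) m (λ v _ → <ᶜ-wrap (first v) (suc (suc c)) (suc n) (1≤first v) (first≤1+n v) (first≢end v)))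
    claim-wrap zero    T m zero m≡0 claim =
      ~-respects (P-wrap₀ T m (G₀-empty m m≡0)) (Q-wrap₀ m m≡0) (~-+ claim (~-refl 1#))
    claim-wrap (suc l) T m zero m≡1+l = ~-respects (trans (P-wrap₀ T m (G₀-nonempty m m≡1+l)) (+-identityʳ _))
      (Q-cong (suc l) (1 , suc n) (2 , 1) m (λ v _ → <ᶜ-wrap (first v) 1 (suc n) (1≤first v) (first≤1+n v) (first-∷≢end v)))

    claim-uncolored : ∀ l T m c (k : Fin n) → lookup r k ≤ c → Claim l T m c (suc (toℕ k)) → Claim l T m c (toℕ k)
    claim-uncolored l T m c k r≤c = ~-respects (P-cong T c (toℕ k) c (suc (toℕ k)) m (λ t → G-uncolored t c k m r≤c))
      (Q-cong l (suc c , suc (toℕ k)) (suc c , suc (suc (toℕ k))) m (λ v _ → <ᶜ-step (first v) (suc c) (suc (toℕ k)) (first-uncolored k r≤c v)))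

    claim-absent : ∀ l T m c (k : Fin n) → lookup m k ≡ 0 → Claim l T m c (suc (toℕ k)) → Claim l T m c (toℕ k)
    claim-absent l T m c k m≡0 = ~-respects (P-cong T c (toℕ k) c (suc (toℕ k)) m (λ t → G-absent t c k m m≡0))
      (Q-cong l (suc c , suc (toℕ k)) (suc c , suc (suc (toℕ k))) m (λ v content → <ᶜ-step (first v) (suc c) (suc (toℕ k)) (first-absent {m} k m≡0 v content)))

    claim-letter : ∀ l T m c (k : Fin n) {M} → c < lookup r k → lookup m k ≡ suc M →
                   Claim l T (updateAt m k pred) c (toℕ k) →
                   Claim (suc l) T m c (suc (toℕ k)) → Claim (suc l) T m c (toℕ k)
    claim-letter l T m c k c<r mk≡1+M claim′ claim = ~-respects (P-letter T c k m c<r mk≡1+M) Q≈ (~-+ claim (~-*ˡ (z k ^ c) claim′))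
      where
      Q≈ : Q (suc l) (suc c , suc (toℕ k)) m ≈
           Q (suc l) (suc c , suc (suc (toℕ k))) m + z k ^ c * Q l (suc c , suc (toℕ k)) (updateAt m k pred)
      Q≈ = ≡.subst (λ d → Q (suc l) (suc d , suc (toℕ k)) m ≈
             Q (suc l) (suc d , suc (suc (toℕ k))) m + z k ^ d * Q l (suc d , suc (toℕ k)) (updateAt m k pred))
             (Fin.toℕ-fromℕ< c<r) (Q-letter l m k (fromℕ< c<r) mk≡1+M)

    -- Induction on j = n - k, from the appended letter downwards.
    claim-color : ∀ l T m c → (∀ k → Claim l T m c (suc (toℕ k)) → Claim l T m c (toℕ k)) →
                  Claim l T m c n → ∀ j k → j ℕ.+ k ≡ n → Claim l T m c k
    claim-color l T m c step last zero    k ≡.refl = last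
    claim-color l T m c step last (suc j) k j+k≡n = ≡.subst (Claim l T m c) (Fin.toℕ-fromℕ< k<n)
      (step (fromℕ< k<n) (claim-color l T m c step last j _ (≡.trans (≡.cong (λ i → j ℕ.+ suc i) (Fin.toℕ-fromℕ< k<n)) (≡.trans (ℕ.+-suc j k) j+k≡n))))
      where
      k<n : k < n
      k<n = ≡.subst (k <_) j+k≡n (s≤s (ℕ.m≤n+m k j))

    -- If k lacks the color c or does not occur, both sides stay the same; otherwise the claim for m
    -- - e_k at the same bound enters, with length one less. The mutual recursion thus lowers `l`,
    -- `T` or the distance `e` of the color from `C`.
    letters : ∀ l T m → Vec.sum m ≡ l → ∀ e c → e ℕ.+ c ≡ C → ∀ (k : Fin n) →
              Claim l T m c (suc (toℕ k)) → Claim l T m c (toℕ k)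

    -- The bound descends from beyond all letters (c = C + 1), where the claim for T - 1 applies, to (c , k).
    claims : ∀ l T m → Vec.sum m ≡ l → ∀ e c → e ℕ.+ c ≡ C → ∀ j k → j ℕ.+ k ≡ n → Claim l T m c k

    letters zero    T m m≡l e c e+c≡C k = claim-absent zero T m c k (sum≡0⇒lookup≡0 m m≡l k)
    letters (suc l) T m m≡l e c e+c≡C k with c ℕ.<? lookup r k | lookup m k in mk
    ... | no  c≮r | _     = claim-uncolored (suc l) T m c k (ℕ.≮⇒≥ c≮r)
    ... | yes c<r | zero  = claim-absent (suc l) T m c k mk
    ... | yes c<r | suc M = claim-letter l T m c k c<r mk
      (claims l T (updateAt m k pred) (sum-updateAt-pred m k mk m≡l) e c e+c≡C
        (n ∸ toℕ k) (toℕ k) (ℕ.m∸n+n≡m (ℕ.<⇒≤ (Fin.toℕ<n k))))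

    claims l zero    m m≡l e c e+c≡C j k j+k≡n = ~-zero _ _
    claims l (suc T) m m≡l zero    c e+c≡C = claim-color l (suc T) m c (letters l (suc T) m m≡l zero c e+c≡C)
      (claim-wrap l T m c m≡l (≡.subst (λ c → Claim l (suc T) m (suc c) 0) (≡.sym e+c≡C)
        (claim-end l T m (claims l T m m≡l C 0 (ℕ.+-identityʳ C) n 0 (ℕ.+-identityʳ n)))))
    claims l (suc T) m m≡l (suc e) c e+c≡C = claim-color l (suc T) m c (letters l (suc T) m m≡l (suc e) c e+c≡C)
      (claim-wrap l T m c m≡l (claims l (suc T) m m≡l e (suc c) (≡.trans (ℕ.+-suc e c) e+c≡C) n 0 (ℕ.+-identityʳ n)))

    partialSum~ : ∀ T m → ∑ (upTo T) (λ t → w ^ t * ∏ (allFin n) (λ i → h (z i) (suc (lookup r i ℕ.* t)) (lookup m i)))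
                  ~[ T ] ∑-content (Vec.sum m) m s
    partialSum~ T m = ~-respects (∑.⨁-cong (upTo T) (λ t → *-congˡ (sym (G-first t m)))) (sym (Q-first (Vec.sum m) m))
      (claims (Vec.sum m) T m ≡.refl C 0 (ℕ.+-identityʳ C) n 0 (ℕ.+-identityʳ n))

-- Gaussian binomials and the summands as power series

module GaussianBinomial {a ℓ} (R : CommutativeRing a ℓ) (q : CommutativeRing.Carrier R) where
  open CommutativeRing R hiding (zero)
  open import Relation.Binary.Reasoning.Setoid setoid
  open Exp semiring using (_^_; ^-congʳ; ^-homo-*)
  open RingSums R
  open Multisets R
  open GeometricSum R using (1-x+x)
  open NaturalCoefficients commutativeSemiring using (solve; _:+_; _:*_; _:=_)

  x+y≈1⇒x≈1-y : ∀ {x y} → x + y ≈ 1# → x ≈ 1# - y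
  x+y≈1⇒x≈1-y {x} {y} x+y≈1 = begin
    x              ≈⟨ +-identityʳ x ⟨
    x + 0#         ≈⟨ +-congˡ (-‿inverseʳ y) ⟨
    x + (y - y)    ≈⟨ +-assoc x y (- y) ⟨
    x + y - y      ≈⟨ +-congʳ x+y≈1 ⟩
    1# - y         ∎

  numerator : ℕ → ℕ → Carrier
  numerator l M = ∏ (upTo M) (λ i → 1# - q ^ (l ℕ.+ i))

  denominator : ℕ → Carrier
  denominator M = ∏ (upTo M) (λ i → 1# - q ^ suc i)

  numerator-first : ∀ l M → numerator l (suc M) ≈ (1# - q ^ l) * numerator (suc l) M
  numerator-first l M = trans (reflexive (∏.⨁-upTo M _)) (*-cong (+-congˡ (-‿cong (^-congʳ q (ℕ.+-identityʳ l))))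
    (∏.⨁-cong (upTo M) (λ i → +-congˡ (-‿cong (^-congʳ q (ℕ.+-suc l i))))))

  1-ab : ∀ x y → y * (1# - x) + (1# - y) ≈ 1# - x * y
  1-ab x y = x+y≈1⇒x≈1-y (begin
    y * (1# - x) + (1# - y) + x * y  ≈⟨ solve 4 (λ x y u v → y :* u :+ v :+ x :* y := v :+ y :* (u :+ x)) refl x y (1# - x) (1# - y) ⟩
    1# - y + y * (1# - x + x)        ≈⟨ +-congˡ (trans (*-congˡ (1-x+x x)) (*-identityʳ y)) ⟩
    1# - y + y                       ≈⟨ 1-x+x y ⟩
    1#                               ∎)

  -- The two terms of the recursion of `h` share the factor `Y`, and q^(M+1) (1 - q^l) + (1 -
  -- q^(M+1)) = 1 - q^(l+M+1) supplies the last factor of the numerator.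
  h-denominator : ∀ l M → h q l M * denominator M ≈ numerator l M
  h-denominator l       zero    = *-identityˡ 1#
  -- The numerator starts with 1 - q^0 = 0.
  h-denominator zero    (suc M) = trans (zeroˡ _) (sym (trans (numerator-first 0 M) (trans (*-congʳ (-‿inverseʳ 1#)) (zeroˡ _))))
  h-denominator (suc l) (suc M) = begin
    (q ^ suc M * h q l (suc M) + h q (suc l) M) * denominator (suc M)
      ≈⟨ distribʳ _ _ _ ⟩
    q ^ suc M * h q l (suc M) * denominator (suc M) + h q (suc l) M * denominator (suc M)
      ≈⟨ +-cong (trans (*-assoc _ _ _) (*-congˡ (trans (h-denominator l (suc M)) (numerator-first l M))))
           (trans (*-congˡ (∏.⨁-upTo-last M _)) (trans (sym (*-assoc _ _ _)) (*-congʳ (h-denominator (suc l) M)))) ⟩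
    q ^ suc M * ((1# - q ^ l) * Y) + Y * (1# - q ^ suc M)
      ≈⟨ solve 4 (λ b u Y v → b :* (u :* Y) :+ Y :* v := Y :* (b :* u :+ v)) refl (q ^ suc M) (1# - q ^ l) Y (1# - q ^ suc M) ⟩
    Y * (q ^ suc M * (1# - q ^ l) + (1# - q ^ suc M))
      ≈⟨ *-congˡ (1-ab (q ^ l) (q ^ suc M)) ⟩
    Y * (1# - q ^ l * q ^ suc M)
      ≈⟨ *-congˡ (+-congˡ (-‿cong (trans (sym (^-homo-* q l (suc M))) (^-congʳ q (ℕ.+-suc l M))))) ⟩
    Y * (1# - q ^ (suc l ℕ.+ M))
      ≈⟨ ∏.⨁-upTo-last M _ ⟨
    numerator (suc l) (suc M)
      ∎
    where Y = numerator (suc l) M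

  ∏-quotients : (inv : Carrier → Carrier) → (∀ i → (1# - q ^ suc i) * inv (1# - q ^ suc i) ≈ 1#) →
                ∀ l M → ∏ (upTo M) (λ i → (1# - q ^ (l ℕ.+ i)) * inv (1# - q ^ suc i)) ≈ h q l M
  ∏-quotients inv inverse l M = begin
    ∏ (upTo M) (λ i → (1# - q ^ (l ℕ.+ i)) * inv (1# - q ^ suc i))
      ≈⟨ ∏.⨁-∙ (upTo M) _ _ ⟩
    numerator l M * ∏ (upTo M) (λ i → inv (1# - q ^ suc i))
      ≈⟨ *-congʳ (h-denominator l M) ⟨
    h q l M * denominator M * ∏ (upTo M) (λ i → inv (1# - q ^ suc i))
      ≈⟨ *-assoc _ _ _ ⟩
    h q l M * (denominator M * ∏ (upTo M) (λ i → inv (1# - q ^ suc i)))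
      ≈⟨ *-congˡ (∏.⨁-∙ (upTo M) _ _) ⟨
    h q l M * ∏ (upTo M) (λ i → (1# - q ^ suc i) * inv (1# - q ^ suc i))
      ≈⟨ *-congˡ (∏.⨁-ε (upTo M) inverse) ⟩
    h q l M * 1#
      ≈⟨ *-identityʳ _ ⟩
    h q l M
      ∎

-- The recurrence of the summands

module FractionRecurrence {a ℓ} (R : CommutativeRing a ℓ) where
  open CommutativeRing R hiding (zero)
  open import Relation.Binary.Reasoning.Setoid setoid
  open GeometricSum R using (1-x+x)
  open NaturalCoefficients commutativeSemiring using (solve; _:+_; _:*_; _:=_; con)

  -- Primes refer to a word with a letter prepended; y is its descent factor at the first position
  -- and T its full tail. Multiply by 1 = (1 - T) + T and note that (1 - T) I′ and I both invert D.
  fraction-recurrence : ∀ x y A B B′ T D D′ I I′ → B′ ≈ y * B → D′ ≈ (1# - T) * D → D * I ≈ 1# → D′ * I′ ≈ 1# →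
                        x * A * B′ * I′ ≈ x * (y * (A * B * I)) + T * (x * A * B′ * I′)
  fraction-recurrence x y A B B′ T D D′ I I′ B′≈yB D′≈UD DI≈1 D′I′≈1 = begin
    X * I′                                         ≈⟨ *-identityʳ _ ⟨
    X * I′ * 1#                                    ≈⟨ *-congˡ (1-x+x T) ⟨
    X * I′ * (U + T)                               ≈⟨ solve 4 (λ X I U T → X :* I :* (U :+ T) := X :* (U :* I) :+ T :* (X :* I)) refl X I′ U T ⟩
    X * (U * I′) + T * (X * I′)                    ≈⟨ +-congʳ (*-cong (*-congˡ B′≈yB) UI′≈I) ⟩
    x * A * (y * B) * I + T * (X * I′)             ≈⟨ +-congʳ (solve 5 (λ x A y B K → x :* A :* (y :* B) :* K := x :* (y :* (A :* B :* K))) refl x A y B I) ⟩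
    x * (y * (A * B * I)) + T * (X * I′)           ∎
    where
    U = 1# - T
    X = x * A * B′
    UI′≈I : U * I′ ≈ I
    UI′≈I = begin
      U * I′              ≈⟨ *-identityʳ _ ⟨
      U * I′ * 1#         ≈⟨ *-congˡ DI≈1 ⟨
      U * I′ * (D * I)    ≈⟨ solve 4 (λ U I′ D I → U :* I′ :* (D :* I) := U :* D :* I′ :* I) refl U I′ D I ⟩
      U * D * I′ * I      ≈⟨ *-congʳ (trans (*-congʳ (sym D′≈UD)) D′I′≈1) ⟩
      1# * I              ≈⟨ *-identityˡ I ⟩
      I                   ∎

  -- The factors 1 mirror the empty products to which `summand r []` unfolds.
  unit-fraction : ∀ w I → (1# - 1# * w) * 1# * I ≈ 1# → 1# * 1# * I ≈ 1# + w * (1# * 1# * I)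
  unit-fraction w I inverse = begin
    1# * 1# * I                           ≈⟨ trans (*-congʳ (*-identityʳ 1#)) (*-identityˡ I) ⟩
    I                                     ≈⟨ *-identityˡ I ⟨
    1# * I                                ≈⟨ *-congʳ (trans (+-congˡ (sym (*-identityˡ w))) (1-x+x (1# * w))) ⟨
    (1# - 1# * w + w) * I                 ≈⟨ solve 3 (λ u w I → (u :+ w) :* I := u :* con 1 :* I :+ w :* (con 1 :* con 1 :* I)) refl (1# - 1# * w) w I ⟩
    (1# - 1# * w) * 1# * I + w * (1# * 1# * I) ≈⟨ +-congʳ inverse ⟩
    1# + w * (1# * 1# * I)                ∎

module _ {d : ℕ} where
  open import Defs using (PowerSeries; Exponent; _≈_; _*_; 1#; _-_; _^_; var; monomial; _⁻¹; ∏; gaussianBinomial)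
  private module 𝓡 = CommutativeRing (powerSeriesRing d)
  private module 𝓢 = RingSums (powerSeriesRing d)

  monomial-≢ : ∀ {α β : Exponent d} → α ≢ β → monomial α β ≡ 0ℤ
  monomial-≢ {α} {β} α≢β = ≡.trans (monomial-does α β)
    (≡.cong (λ b → if b then 1ℤ else 0ℤ) (dec-false (Vec.≡-dec ℕ._≟_ α β) α≢β))

  constant-var : ∀ (i : Fin d) → var i zeros ≡ 0ℤ
  constant-var i = monomial-≢ λ eq → ℕ.1+n≢0 (≡.trans (≡.sym (Vec.lookup∘update i zeros 1))
    (≡.trans (≡.cong (λ α → lookup α i) eq) (Vec.lookup-replicate i 0)))

  constant-*ˡ : ∀ (f g : PowerSeries d) → f zeros ≡ 0ℤ → (f * g) zeros ≡ 0ℤ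
  constant-*ˡ f g f₀≡0 = ≡.trans (constant-* f g) (≡.trans (≡.cong (ℤ._* g zeros) f₀≡0) (ℤ.*-zeroˡ (g zeros)))

  constant-*ʳ : ∀ (f g : PowerSeries d) → g zeros ≡ 0ℤ → (f * g) zeros ≡ 0ℤ
  constant-*ʳ f g g₀≡0 = ≡.trans (constant-* f g) (≡.trans (≡.cong (f zeros ℤ.*_) g₀≡0) (ℤ.*-zeroʳ (f zeros)))

  constant-1- : ∀ (f : PowerSeries d) → f zeros ≡ 0ℤ → (1# - f) zeros ≡ 1ℤ
  constant-1- f f₀≡0 = ≡.trans (≡.cong₂ (λ x y → x ℤ.- y) (constant-1# d) f₀≡0) (ℤ.+-identityʳ 1ℤ)

  constant-∏ : ∀ {b} {B : Set b} (xs : List B) (f : B → PowerSeries d) → (∀ x → f x zeros ≡ 1ℤ) → (∏ xs f) zeros ≡ 1ℤ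
  constant-∏ []       f f₀≡1 = constant-1# d
  constant-∏ (x ∷ xs) f f₀≡1 = ≡.trans (constant-* (f x) (∏ xs f)) (≡.cong₂ ℤ._*_ (f₀≡1 x) (constant-∏ xs f f₀≡1))

  -- With N = L + M the exponents N + (i + 1) - M are L + 1 + i, whence `suc L`. As q has no
  -- constant term, each 1 - q^(i+1) is invertible.
  gaussianBinomial-h : ∀ L M (q : PowerSeries d) → q zeros ≡ 0ℤ →
                       gaussianBinomial (L ℕ.+ M) M q ≈ Multisets.h (powerSeriesRing d) q (suc L) M
  gaussianBinomial-h L M q q₀≡0 = 𝓡.trans
    (𝓡.reflexive (𝓢.∏.⨁-map suc (upTo M) (λ i → (1# - q ^ ((L ℕ.+ M ℕ.+ i) ∸ M)) * (1# - q ^ i) ⁻¹)))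
    (𝓡.trans
      (𝓢.∏.⨁-cong (upTo M) (λ i → 𝓡.reflexive (≡.cong (λ e → (1# - q ^ e) * (1# - q ^ suc i) ⁻¹) (exponent i))))
      (∏-quotients _⁻¹ (λ i → ⁻¹-inverseʳ (1# - q ^ suc i) (constant-1- (q ^ suc i) (constant-*ˡ q (q ^ i) q₀≡0))) (suc L) M))
    where
    open GaussianBinomial (powerSeriesRing d) q using (∏-quotients)
    exponent : ∀ i → (L ℕ.+ M ℕ.+ suc i) ∸ M ≡ suc L ℕ.+ i
    exponent i = ≡.trans (≡.cong (_∸ M) (≡.trans (≡.cong (ℕ._+ suc i) (ℕ.+-comm L M)) (ℕ.+-assoc M L (suc i))))
      (≡.trans (ℕ.m+n∸m≡n M (L ℕ.+ suc i)) (ℕ.+-suc L i))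

open import Defs

module Summand {n} (r : Vec ℕ n) where
  private module 𝓟 = CommutativeRing (powerSeriesRing (suc n))
  open RingSums (powerSeriesRing (suc n)) using (module ∏)
  open FractionRecurrence (powerSeriesRing (suc n))

  Num₁ Num₂ Den : ∀ {l} → Word r l → PowerSeries (suc n)
  Num₁ w = ∏[ x ∈ toList w ] (z (proj₁ x) ^ toℕ (proj₂ x))
  Num₂ w = ∏[ j ∈ DES r w ] tailMonomial r w (suc j)
  Den {l} w = ∏[ i ∈ allFin (suc l) ] (1# - tailMonomial r w i)

  constant-Den : ∀ {l} (v : Word r l) → Den v zeros ≡ 1ℤ
  constant-Den {l} v = constant-∏ (allFin (suc l)) (λ i → 1# - tailMonomial r v i) (λ i →
    constant-1- (tailMonomial r v i) (constant-*ʳ (∏[ x ∈ drop (toℕ i) (toList v) ] (z (proj₁ x) ^ lookup r (proj₁ x))) zₘ₊₁ (constant-var {suc n} zero)))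

  Den-inverse : ∀ {l} (v : Word r l) → Den v * Den v ⁻¹ ≈ 1#
  Den-inverse v = ⁻¹-inverseʳ (Den v) (constant-Den v)

  Den-∷ : ∀ {l} x (v : Word r l) → Den (x ∷ v) ≈ (1# - tailMonomial r (x ∷ v) zero) * Den v
  Den-∷ {l} x v = 𝓟.reflexive (∏.⨁-allFin (suc l) (λ i → 1# - tailMonomial r (x ∷ v) i))

  descentFactor : ColoredLetter r → ∀ {l} → Word r l → PowerSeries (suc n)
  descentFactor x v = if does (lookup (extend r v) zero <ᶜ? toColoredInteger r x) then tailMonomial r v zero else 1#

  -- Later descents of x ∷ v are definitionally those of v, with the same tails; only the position
  -- between x and v is new.
  Num₂-∷ : ∀ {l} x (v : Word r l) → Num₂ (x ∷ v) ≈ descentFactor x v * Num₂ v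
  Num₂-∷ {l} x v = ∏.⨁-filter-allFin (isDescent? r (x ∷ v)) (isDescent? r v) (λ _ → ≡.refl)
    (λ j → tailMonomial r (x ∷ v) (suc j))

  summand-∷ : ∀ {l} x (v : Word r l) → summand r (x ∷ v) ≈
              z (proj₁ x) ^ toℕ (proj₂ x) * (descentFactor x v * summand r v) + tailMonomial r (x ∷ v) zero * summand r (x ∷ v)
  summand-∷ x v = fraction-recurrence (z (proj₁ x) ^ toℕ (proj₂ x)) (descentFactor x v) (Num₁ v) (Num₂ v) (Num₂ (x ∷ v))
    (tailMonomial r (x ∷ v) zero) (Den v) (Den (x ∷ v)) (Den v ⁻¹) (Den (x ∷ v) ⁻¹)
    (Num₂-∷ x v) (Den-∷ x v) (Den-inverse v) (Den-inverse (x ∷ v))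

  summand-[] : summand r [] ≈ 1# + zₘ₊₁ * summand r []
  summand-[] = unit-fraction zₘ₊₁ (Den [] ⁻¹) (Den-inverse [])

theorem1 : (n : ℕ) → 1 ≤ n →
    (m r : Vec ℕ n) → (∀ k → 1 ≤ lookup m k) → (∀ k → 1 ≤ lookup r k) →
    HasSum
    (λ t → zₘ₊₁ ^ t *
    (∏[ k ∈ allFin n ] gaussianBinomial (lookup r k ℕ.* t ℕ.+ lookup m k) (lookup m k) (z k)))
    (∑[ w ∈ coloredPermutations r m ] summand r w)
-- For T > `head α` the error, z_{m+1}^T times a quotient, does not reach the coefficient at α.
theorem1 n _ m r _ 1≤r α = suc (head α) , λ T head<T →
  ≡.trans (agree T α) (≡.trans
    (≡.cong₂ (λ x y → x ℤ.+ y) (𝓟.sym (∑.⨁-filter (isColoredPermutation? r m) (words r (Vec.sum m)) (summand r)) α)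
      (vanish T α head<T))
    (ℤ.+-identityʳ _))
  where
  module 𝓟 = CommutativeRing (powerSeriesRing (suc n))
  open RingSums (powerSeriesRing (suc n)) using (module ∑; module ∏)
  open Summand r
  open WordSide (powerSeriesRing (suc n)) r 1≤r z zₘ₊₁ using (partialSum~; _~[_]_; ∑-content)
  open _~[_]_
  open Order {suc n} head head-+

  sums : ∀ T → _
  sums T = partialSum~ (λ {l} → summand r {l}) summand-[] summand-∷ T m

  agree : ∀ T → (∑[ t ∈ upTo T ] (zₘ₊₁ ^ t *
            (∏[ k ∈ allFin n ] gaussianBinomial (lookup r k ℕ.* t ℕ.+ lookup m k) (lookup m k) (z k)))) ≈
          ∑-content (Vec.sum m) m (summand r) + zₘ₊₁ ^ T * quotient (sums T)
  agree T = 𝓟.trans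
    (∑.⨁-cong (upTo T) (λ t → 𝓟.*-congˡ {zₘ₊₁ ^ t} (∏.⨁-cong (allFin n) (λ k →
      gaussianBinomial-h (lookup r k ℕ.* t) (lookup m k) (z k) (constant-var (suc k))))))
    (equality (sums T))

  order-zₘ₊₁ : HasOrder 1 zₘ₊₁
  order-zₘ₊₁ (zero  ∷ β) _ = monomial-≢ {α = 1 ∷ zeros} {zero ∷ β} λ ()
  order-zₘ₊₁ (suc _ ∷ β) (s≤s ())

  vanish : ∀ T α → head α < T → (zₘ₊₁ ^ T * quotient (sums T)) α ≡ 0ℤ
  -- Every series, in particular the quotient, has order 0 vacuously.
  vanish T α head<T = order-* {T} {0} (zₘ₊₁ ^ T) (quotient (sums T)) (order-^ zₘ₊₁ order-zₘ₊₁ T) (λ _ ()) α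
    (≡.subst (head α <_) (≡.sym (ℕ.+-identityʳ T)) head<T)
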